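{- For every composition $\alpha$, $$\Delta(\mathcal p_\alpha)=\sum_{\alpha=\beta\cdot\gamma}\frac{z_\alpha}{z_\beta z_\gamma}\,\mathcal p_\beta\otimes\mathcal p_\gamma ,$$ the sum being over all ways to write $\alpha$ as a concatenation of two (possibly empty) compositions $\beta,\gamma$.
   Context: $\mathrm{QSym}$ is the Hopf algebra of quasisymmetric functions in $x_1,x_2,\dots$ over $\mathbb Q$ with its standard coproduct $\Delta$, determined by $\Delta(M_\alpha)=\sum_{\alpha=\beta\cdot\gamma}M_\beta\otimes M_\gamma$, where $M_\alpha=\sum_{i_1<\dots<i_\ell}x_{i_1}^{\alpha_1}\cdots x_{i_\ell}^{\alpha_\ell}$ and $M_\emptyset=1$. Let $\mathbb N=\{1,2,\dots\}$. A composition is a finite sequence of positive integers (possibly empty); $\widetilde\alpha$ sorts the parts weakly decreasingly; $\beta\cdot\gamma$ is concatenation. If $\widetilde\alpha=n^{r_n}\cdots1^{r_1}$ ($r_i$ parts equal to $i$), $z_\alpha=\prod_i i^{r_i}r_i!$. A labelling of a finite poset $P$ is an injective map $\gamma$ into a chain; a weight function is $w:P\to\mathbb N$. A $(P,\gamma)$-partition is $f:P\to\mathbb N$ with, for all $p<q$, $f(p)\le f(q)$, and $f(p)=f(q)\Rightarrow\gamma(p)<\gamma(q)$. $K_{(P,\gamma,w)}=\sum_f\prod_{u\in P}x_{f(u)}^{w(u)}$ over all $(P,\gamma)$-partitions. For a chain $u_1<\dots<u_\ell$, $\alpha(s,w)=(w(u_1),\dots,w(u_\ell))$. Let $\mathbb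 N_{\mathbb N}=\{a_k:a,k\in\mathbb N\}$ ordered by $a_k<b_l$ iff $a<b$, or $a=b$ and $k<l$; $\mathbb N_{\mathbb N}^*$ is its reverse. $P^{\widetilde\alpha}$ is the antichain on $\{a_k:1\le a\le n,1\le k\le r_a\}$ with $w(a_k)=a$ and labelling $\gamma$ the inclusion into $\mathbb N_{\mathbb N}^*$. The combinatorial power sum is $\mathcal p_\alpha=\sum_sK_{(s,\gamma,w)}$ over linear extensions $s$ of $P^{\widetilde\alpha}$ with $\alpha(s,w)=\alpha$ (so $\mathcal p_\emptyset=1$). -}

module Defs where

open import Data.Bool using (Bool; true; false; _∧_; _∨_; not)
open import Data.Nat using (ℕ; zero; suc; _+_; _*_; _^_; _⊔_; _<_; _<ᵇ_; _≡ᵇ_; _≤ᵇ_; _!; NonZero)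
open import Data.Nat.Properties using (m*n≢0; m^n≢0; _!≢0)
import Data.Nat.Properties as ℕP
open import Data.Fin using (Fin; toℕ)
open import Data.List using (List; []; _∷_; _++_; map; concatMap; length; filterᵇ; upTo; allFin; foldr; lookup)
open import Data.Nat.ListAction using (sum; product)
open import Data.Bool.ListAction using (all; any)
import Data.List.Properties as LP
open import Data.List.Relation.Unary.All using (All)
open import Data.Vec using (Vec)
import Data.Vec as V
open import Data.Product using (_×_; _,_; proj₁; proj₂)
open import Data.Integer using (+_)
open import Data.Rational using (ℚ; 0ℚ; _/_) renaming (_+_ to _+ℚ_; _*_ to _*ℚ_)
open import Relation.Nullary using (does)
open import Relation.Binary.PropositionalEquality using (_≡_)

IsComposition : List ℕ → Set
IsComposition α = All (λ a → 0 < a) α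

range1 : ℕ → List ℕ
range1 n = map suc (upTo n)

mult : ℕ → List ℕ → ℕ
mult a α = length (filterᵇ (λ b → a ≡ᵇ b) α)

maxPart : List ℕ → ℕ
maxPart = foldr _⊔_ 0

zTerm : List ℕ → ℕ → ℕ
zTerm α i = i ^ mult i α * mult i α !

z : List ℕ → ℕ
z α = product (map (zTerm α) (range1 (maxPart α)))

private
  zNZ′ : (α : List ℕ) (xs : List ℕ) → NonZero (product (map (zTerm α) (map suc xs)))
  zNZ′ α [] = _
  zNZ′ α (x ∷ xs) =
    let instance
          _ = zNZ′ α xs
          _ = m^n≢0 (suc x) (mult (suc x) α)
          _ = mult (suc x) α !≢0
          _ = m*n≢0 (suc x ^ mult (suc x) α) (mult (suc x) α !)
    in m*n≢0 (zTerm α (suc x)) (product (map (zTerm α) (map suc xs)))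

zz-nonZero : (β γ : List ℕ) → NonZero (z β * z γ)
zz-nonZero β γ =
  let instance
        _ = zNZ′ β (upTo (maxPart β))
        _ = zNZ′ γ (upTo (maxPart γ))
  in m*n≢0 (z β) (z γ)

zRatio : List ℕ → List ℕ → List ℕ → ℚ
zRatio α β γ = _/_ (+ z α) (z β * z γ) {{zz-nonZero β γ}}

splits : {A : Set} → List A → List (List A × List A)
splits [] = ([] , []) ∷ []
splits (x ∷ xs) = ([] , x ∷ xs) ∷ map (λ p → (x ∷ proj₁ p , proj₂ p)) (splits xs)

allVecs : (m n : ℕ) → List (Vec (Fin m) n)
allVecs m zero = V.[] ∷ []
allVecs m (suc n) = concatMap (λ x → map (x V.∷_) (allVecs m n)) (allFin m)

allFinᵇ : (n : ℕ) → (Fin n → Bool) → Bool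
allFinᵇ n p = all p (allFin n)

anyFinᵇ : (n : ℕ) → (Fin n → Bool) → Bool
anyFinᵇ n p = any p (allFin n)

_≡Finᵇ_ : {n : ℕ} → Fin n → Fin n → Bool
i ≡Finᵇ j = toℕ i ≡ᵇ toℕ j

_<Finᵇ_ : {n : ℕ} → Fin n → Fin n → Bool
i <Finᵇ j = toℕ i <ᵇ toℕ j

_≤Finᵇ_ : {n : ℕ} → Fin n → Fin n → Bool
i ≤Finᵇ j = toℕ i ≤ᵇ toℕ j

-- a_k is encoded as the pair (a , k).
-- Order on ℕ_ℕ: a_k < b_l iff a < b, or a = b and k < l.
_<NNᵇ_ : ℕ × ℕ → ℕ × ℕ → Bool
(a , k) <NNᵇ (b , l) = (a <ᵇ b) ∨ ((a ≡ᵇ b) ∧ (k <ᵇ l))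

-- γ(p) < γ(q) in ℕ_ℕ^* (the reverse of ℕ_ℕ)
_<γᵇ_ : ℕ × ℕ → ℕ × ℕ → Bool
p <γᵇ q = q <NNᵇ p

-- underlying set of P^{α̃}: { a_k : 1 ≤ a ≤ n, 1 ≤ k ≤ r_a }  (an antichain)
elems : List ℕ → List (ℕ × ℕ)
elems α = concatMap (λ a → map (λ k → (a , k)) (range1 (mult a α))) (range1 (maxPart α))

module _ (α : List ℕ) where

  card : ℕ
  card = length (elems α)

  elt : Fin card → ℕ × ℕ
  elt = lookup (elems α)

  wt : Fin card → ℕ
  wt e = proj₁ (elt e)

  -- A linear extension s of the antichain P^{α̃} is a total order on P, i.e. a
  -- listing u_1 < ... < u_N of its elements: a bijection σ from positions
  -- Fin card onto P (u_{i+1} = elt (σ i)).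
  isBijᵇ : Vec (Fin card) card → Bool
  isBijᵇ σ =
    allFinᵇ card (λ i → allFinᵇ card (λ j →
      not (V.lookup σ i ≡Finᵇ V.lookup σ j) ∨ (i ≡Finᵇ j)))
    ∧ allFinᵇ card (λ e → anyFinᵇ card (λ i → V.lookup σ i ≡Finᵇ e))

  αsw : Vec (Fin card) card → List ℕ
  αsw σ = map (λ i → wt (V.lookup σ i)) (allFin card)

  isLinExtWithᵇ : Vec (Fin card) card → Bool
  isLinExtWithᵇ σ = isBijᵇ σ ∧ does (LP.≡-dec ℕP._≟_ (αsw σ) α)

  -- f : P → {1,…,m} (value v : Fin m stands for the variable x_{v+1}) is an
  -- (s,γ)-partition: for all p < q in the chain s, f(p) ≤ f(q) and
  -- f(p) = f(q) ⇒ γ(p) < γ(q).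
  isPartitionᵇ : {m : ℕ} → Vec (Fin card) card → Vec (Fin m) card → Bool
  isPartitionᵇ σ f =
    allFinᵇ card (λ i → allFinᵇ card (λ j →
      let p = V.lookup σ i ; q = V.lookup σ j in
      not (i <Finᵇ j)
      ∨ ((V.lookup f p ≤Finᵇ V.lookup f q)
         ∧ (not (V.lookup f p ≡Finᵇ V.lookup f q) ∨ (elt p <γᵇ elt q)))))

  -- ∏_{u ∈ P} x_{f(u)}^{w(u)} equals the monomial x_1^{δ_1} ⋯ x_m^{δ_m}
  -- (m = length δ).
  hasMonomialᵇ : (δ : List ℕ) → Vec (Fin (length δ)) card → Bool
  hasMonomialᵇ δ f =
    allFinᵇ (length δ) (λ v →
      sum (map wt (filterᵇ (λ e → V.lookup f e ≡Finᵇ v) (allFin card))) ≡ᵇ lookup δ v)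

  -- Coefficient of M_δ in 𝓅_α = ∑_s K_{(s,γ,w)}, i.e. the coefficient of the
  -- monomial x_1^{δ_1} ⋯ x_m^{δ_m}: the number of pairs (s , f) with s a
  -- linear extension of P^{α̃} with α(s,w) = α and f an (s,γ)-partition with
  -- that monomial.
  pCoeff : List ℕ → ℕ
  pCoeff δ =
    sum (map (λ σ → length (filterᵇ (λ f → isPartitionᵇ σ f ∧ hasMonomialᵇ δ f)
                                     (allVecs (length δ) card)))
             (filterᵇ isLinExtWithᵇ (allVecs card card)))

-- An element of QSym, given by its coefficients in the basis (M_δ)_δ.
QSym : Set
QSym = List ℕ → ℚ

-- An element of QSym ⊗ QSym, given by its coefficients in the basis
-- (M_β ⊗ M_γ)_{β,γ}.
QSym⊗QSym : Set
QSym⊗QSym = List ℕ → List ℕ → ℚ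

𝓅 : List ℕ → QSym
𝓅 α δ = (+ pCoeff α δ) / 1

-- Δ(∑_δ c_δ M_δ) = ∑_δ c_δ ∑_{δ = β·γ} M_β ⊗ M_γ, so the coefficient of
-- M_β ⊗ M_γ in Δ F is the coefficient of M_{β·γ} in F.
Δ : QSym → QSym⊗QSym
Δ F β γ = F (β ++ γ)

_⊗_ : QSym → QSym → QSym⊗QSym
(F ⊗ G) β γ = F β *ℚ G γ

_·ₜ_ : ℚ → QSym⊗QSym → QSym⊗QSym
(c ·ₜ T) β γ = c *ℚ T β γ

Σₜ : List QSym⊗QSym → QSym⊗QSym
Σₜ [] β γ = 0ℚ
Σₜ (T ∷ Ts) β γ = T β γ +ℚ Σₜ Ts β γ

-- equality in QSym ⊗ QSym: all coefficients on the basis M_β ⊗ M_γ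
-- (β, γ compositions) agree
_≐_ : QSym⊗QSym → QSym⊗QSym → Set
S ≐ T = (β γ : List ℕ) → IsComposition β → IsComposition γ → S β γ ≡ T β γ

{-# OPTIONS --safe #-}
module Submission where

open import Defs
open import Data.Bool using (Bool; true; false; _∧_; _∨_; not; T; T?)
open import Data.Bool.Properties using (T-∧; T-∨; T-≡)
open import Data.Empty using (⊥; ⊥-elim)
open import Data.Fin as Fin using (Fin; zero; suc; toℕ)
import Data.Fin.Properties as FinP
open import Data.Integer as ℤ using () renaming (+_ to pos)
import Data.Integer.Properties as ℤP
open import Data.List
  using (List; []; _∷_; _++_; _∷ʳ_; map; concat; concatMap; length; filterᵇ; upTo; reverse; replicate;
         null; allFin; tabulate; foldr)
import Data.List as L
open import Data.List.Membership.Propositional using (_∈_)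
open import Data.List.Membership.Propositional.Properties
  using (∈-lookup; ∈-concat⁺′; ∈-tabulate⁺; ∈-tabulate⁻; ∈-allFin; ∈-filter⁺; ∈-filter⁻)
open import Data.List.Properties
  using (≡-dec; ++-assoc; ++-identityʳ; map-++; map-∘; map-id; map-cong; map-tabulate; map-concatMap;
         concat-map; concatMap-++; concatMap-cong; filter-++; length-++; length-map; length-upTo;
         upTo-∷ʳ; unfold-reverse; tabulate-cong; tabulate-lookup)
open import Data.List.Relation.Binary.Permutation.Propositional.Properties using (↭-reverse)
open import Data.List.Relation.Unary.All as All using (All; []; _∷_)
import Data.List.Relation.Unary.All.Properties as AllP
open import Data.List.Relation.Unary.AllPairs as AllPairs using (AllPairs; []; _∷_)
import Data.List.Relation.Unary.AllPairs.Properties as AllPairsP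
open import Data.List.Relation.Unary.Any using (here; there)
import Data.List.Relation.Unary.Any.Properties as AnyP
open import Data.List.Relation.Unary.Unique.Propositional using (Unique)
import Data.List.Relation.Unary.Unique.Propositional.Properties as UniqueP
open import Data.Nat
  using (ℕ; zero; suc; _+_; _*_; _^_; _!; _∸_; _⊔_; _≤_; _<_; _≡ᵇ_; _<ᵇ_; s≤s; NonZero)
open import Data.Nat.ListAction using (sum; product)
open import Data.Nat.ListAction.Properties using (product-++; sum-↭)
open import Data.Nat.Properties
open import Data.Nat.Tactic.RingSolver using (solve-∀)
open import Data.Product using (_×_; _,_; proj₁; proj₂; map₁; map₂; ∃)
open import Data.Rational using (_/_; toℚᵘ) renaming (_+_ to _+ℚ_; _*_ to _*ℚ_)
import Data.Rational.Properties as ℚP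
open import Data.Rational.Unnormalised as ℚᵘ using (mkℚᵘ; *≡*)
import Data.Rational.Unnormalised.Properties as ℚᵘP
open import Data.Sum using (_⊎_; inj₁; inj₂)
open import Data.Vec as V using (Vec; []; _∷_)
import Data.Vec.Properties as VP
open import Function using (_∘_; id; flip)
open import Function.Bundles using (Equivalence)
open import Relation.Binary using (tri<; tri≈; tri>)
open import Relation.Binary.PropositionalEquality
open import Relation.Nullary using (does; yes; no; ¬_)

-- An (s,γ)-partition f determines s: the elements are listed by increasing
-- value of f and, within a fibre of f, against the order of ℕ_ℕ.  Hence the
-- coefficient of M_δ in 𝓅_α counts the maps f alone, that is, the ways of
-- dealing the sorted parts of α to blocks with sums δ₁, δ₂, … whose reversals
-- concatenate to α.  For a concatenation of two indices δ and ε, one first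
-- deals the letters to a left hand (for δ) and a right hand (for ε).  A split
-- α = β·γ contributes only if the hands are rearrangements of β and γ, and
-- this happens for z_α / (z_β z_γ) = ∏_a binom(r_a(α), r_a(β)) of the deals.

-- The count stays in ℕ with denominators cleared: a binomial coefficient appears only as a count
-- that, multiplied by p! q!, equals (p+q)! times a value, and the powers in `z` cancel because a^p
-- a^q = a^(p+q). Rationals enter only in the final comparison of coefficients. All deals are
-- summed, with no condition on the hands: a reading of blocks always permutes the letters dealt, so
-- hands with the wrong multiplicities contribute zero. The remaining deals of a sorted word all
-- produce the same pair of sorted hands, since equal letters become indistinguishable once the
-- index k of a_k is dropped. This is why words of weights are dealt, and not words of elements. The
-- main obstacle is a change of recursion. A map f is given by a value for each element, whereas
-- factoring over a concatenation of indices calls for choosing the elements of each block.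

private variable
  A B : Set
  m n : ℕ

-- Finite sums and indicators in ℕ

∑ : List A → (A → ℕ) → ℕ
∑ xs h = sum (map h xs)

𝟙 : Bool → ℕ
𝟙 true  = 1
𝟙 false = 0

𝟙-∧ : ∀ a b → 𝟙 (a ∧ b) ≡ 𝟙 a * 𝟙 b
𝟙-∧ true  b = sym (*-identityˡ (𝟙 b))
𝟙-∧ false b = refl

∑-congAll : (xs : List A) {g h : A → ℕ} → All (λ x → g x ≡ h x) xs → ∑ xs g ≡ ∑ xs h
∑-congAll []       []       = refl
∑-congAll (x ∷ xs) (p ∷ ps) = cong₂ _+_ p (∑-congAll xs ps)

∑-cong : (xs : List A) {g h : A → ℕ} → (∀ x → g x ≡ h x) → ∑ xs g ≡ ∑ xs h
∑-cong xs p = ∑-congAll xs (All.universal p xs)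

∑-zero : (xs : List A) → ∑ xs (λ _ → 0) ≡ 0
∑-zero []       = refl
∑-zero (x ∷ xs) = ∑-zero xs

∑-+ : (xs : List A) (g h : A → ℕ) → ∑ xs (λ x → g x + h x) ≡ ∑ xs g + ∑ xs h
∑-+ []       g h = refl
∑-+ (x ∷ xs) g h = trans (cong (g x + h x +_) (∑-+ xs g h)) (lemma (g x) (h x) (∑ xs g) (∑ xs h))
  where
  lemma : ∀ a b c d → a + b + (c + d) ≡ a + c + (b + d)
  lemma = solve-∀

∑-*ˡ : (xs : List A) (k : ℕ) (h : A → ℕ) → ∑ xs (λ x → k * h x) ≡ k * ∑ xs h
∑-*ˡ []       k h = sym (*-zeroʳ k)
∑-*ˡ (x ∷ xs) k h = trans (cong (k * h x +_) (∑-*ˡ xs k h)) (sym (*-distribˡ-+ k (h x) (∑ xs h)))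

∑-swap : (xs : List A) (ys : List B) (h : A → B → ℕ) →
         ∑ xs (λ x → ∑ ys (h x)) ≡ ∑ ys (λ y → ∑ xs (λ x → h x y))
∑-swap []       ys h = sym (∑-zero ys)
∑-swap (x ∷ xs) ys h =
  trans (cong (∑ ys (h x) +_) (∑-swap xs ys h)) (sym (∑-+ ys (h x) (λ y → ∑ xs (λ x′ → h x′ y))))

∑-++ : (xs ys : List A) (h : A → ℕ) → ∑ (xs ++ ys) h ≡ ∑ xs h + ∑ ys h
∑-++ []       ys h = refl
∑-++ (x ∷ xs) ys h = trans (cong (h x +_) (∑-++ xs ys h)) (sym (+-assoc (h x) _ _))

∑-map : (g : A → B) (xs : List A) (h : B → ℕ) → ∑ (map g xs) h ≡ ∑ xs (h ∘ g)
∑-map g []       h = refl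
∑-map g (x ∷ xs) h = cong (h (g x) +_) (∑-map g xs h)

∑-concatMap : (g : A → List B) (xs : List A) (h : B → ℕ) →
              ∑ (concatMap g xs) h ≡ ∑ xs (λ x → ∑ (g x) h)
∑-concatMap g []       h = refl
∑-concatMap g (x ∷ xs) h =
  trans (∑-++ (g x) (concatMap g xs) h) (cong (∑ (g x) h +_) (∑-concatMap g xs h))

∑-filterᵇ : (p : A → Bool) (xs : List A) (h : A → ℕ) →
            ∑ (filterᵇ p xs) h ≡ ∑ xs (λ x → 𝟙 (p x) * h x)
∑-filterᵇ p []       h = refl
∑-filterᵇ p (x ∷ xs) h with p x
... | true  = cong₂ _+_ (sym (*-identityˡ (h x))) (∑-filterᵇ p xs h)
... | false = ∑-filterᵇ p xs h

length-filterᵇ : (p : A → Bool) (xs : List A) → length (filterᵇ p xs) ≡ ∑ xs (𝟙 ∘ p)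
length-filterᵇ p []       = refl
length-filterᵇ p (x ∷ xs) with p x
... | true  = cong suc (length-filterᵇ p xs)
... | false = length-filterᵇ p xs

-- Dealing a word to two hands

-- Deshuffling with multiplicity: n letters give 2^n entries, and deals that agree as pairs of words
-- are counted separately, as they come from different maps `f`. Each hand keeps the order of the
-- word.
deals : List A → List (List A × List A)
deals []       = ([] , []) ∷ []
deals (w ∷ ws) = map (map₁ (w ∷_)) (deals ws) ++ map (map₂ (w ∷_)) (deals ws)

∑-deals-∷ : (w : A) (ws : List A) (K : List A × List A → ℕ) →
            ∑ (deals (w ∷ ws)) K ≡ ∑ (deals ws) (K ∘ map₁ (w ∷_)) + ∑ (deals ws) (K ∘ map₂ (w ∷_))
∑-deals-∷ w ws K =
  trans (∑-++ (map (map₁ (w ∷_)) (deals ws)) _ K)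
        (cong₂ _+_ (∑-map (map₁ (w ∷_)) (deals ws) K) (∑-map (map₂ (w ∷_)) (deals ws) K))

-- Counit law: exactly one deal has an empty left hand.
∑-deals-identityˡ : (ws : List A) (h : List A → ℕ) →
                    ∑ (deals ws) (λ (as , bs) → 𝟙 (null as) * h bs) ≡ h ws
∑-deals-identityˡ []       h = trans (+-identityʳ _) (*-identityˡ (h []))
∑-deals-identityˡ (w ∷ ws) h =
  trans (∑-deals-∷ w ws _)
        (cong₂ _+_ (∑-zero (deals ws)) (∑-deals-identityˡ ws (h ∘ (w ∷_))))

-- Coassociativity: both sides sum over deals to three hands. The next letter goes to one of the
-- three, and the two sides only bracket these three sums differently.
∑-deals-assoc : (ws : List A) (K : List A → List A → List A → ℕ) →
  ∑ (deals ws) (λ (abs , cs) → ∑ (deals abs) (λ (as , bs) → K as bs cs)) ≡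
  ∑ (deals ws) (λ (as , bcs) → ∑ (deals bcs) (λ (bs , cs) → K as bs cs))
∑-deals-assoc []       K = refl
∑-deals-assoc (w ∷ ws) K = begin
  ∑ (deals (w ∷ ws)) L
    ≡⟨ ∑-deals-∷ w ws L ⟩
  ∑ (deals ws) (L ∘ map₁ (w ∷_)) + ∑ (deals ws) (L ∘ map₂ (w ∷_))
    ≡⟨ cong (_+ ∑ (deals ws) (L ∘ map₂ (w ∷_)))
         (trans (∑-cong (deals ws) λ (abs , cs) → ∑-deals-∷ w abs _) (∑-+ (deals ws) _ _)) ⟩
  ∑ (deals ws) _ + ∑ (deals ws) _ + ∑ (deals ws) _
    ≡⟨ cong₂ _+_ (cong₂ _+_ (∑-deals-assoc ws λ as → K (w ∷ as)) (∑-deals-assoc ws λ as bs → K as (w ∷ bs)))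
                 (∑-deals-assoc ws λ as bs cs → K as bs (w ∷ cs)) ⟩
  ∑ (deals ws) _ + ∑ (deals ws) _ + ∑ (deals ws) _
    ≡⟨ +-assoc (∑ (deals ws) _) _ _ ⟩
  ∑ (deals ws) _ + (∑ (deals ws) _ + ∑ (deals ws) _)
    ≡⟨ cong (∑ (deals ws) (R ∘ map₁ (w ∷_)) +_)
         (trans (∑-cong (deals ws) λ (as , bcs) → ∑-deals-∷ w bcs _) (∑-+ (deals ws) _ _)) ⟨
  ∑ (deals ws) (R ∘ map₁ (w ∷_)) + ∑ (deals ws) (R ∘ map₂ (w ∷_))
    ≡⟨ ∑-deals-∷ w ws R ⟨
  ∑ (deals (w ∷ ws)) R ∎
  where
  open ≡-Reasoning
  L R : _ → ℕ
  L = λ (abs , cs) → ∑ (deals abs) (λ (as , bs) → K as bs cs)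
  R = λ (as , bcs) → ∑ (deals bcs) (λ (bs , cs) → K as bs cs)

-- Multiplicities of letters

mult-++ : ∀ a xs ys → mult a (xs ++ ys) ≡ mult a xs + mult a ys
mult-++ a xs ys =
  trans (cong length (filter-++ (T? ∘ (a ≡ᵇ_)) xs ys)) (length-++ (filterᵇ (a ≡ᵇ_) xs))

mult-here : ∀ a xs → mult a (a ∷ xs) ≡ suc (mult a xs)
mult-here a xs with a ≡ᵇ a | ≡⇒≡ᵇ a a refl
... | true | _ = refl

mult-there : ∀ {a b} → a ≢ b → ∀ xs → mult a (b ∷ xs) ≡ mult a xs
mult-there {a} {b} a≢b xs with a ≡ᵇ b in eq
... | true  = ⊥-elim (a≢b (≡ᵇ⇒≡ a b (subst T (sym eq) _)))
... | false = refl

mult-∷ : ∀ a b xs → mult a (b ∷ xs) ≡ mult a (b ∷ []) + mult a xs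
mult-∷ a b xs = mult-++ a (b ∷ []) xs

mult-reverse : ∀ a xs → mult a (reverse xs) ≡ mult a xs
mult-reverse a []       = refl
mult-reverse a (x ∷ xs) = begin
  mult a (reverse (x ∷ xs))              ≡⟨ cong (mult a) (unfold-reverse x xs) ⟩
  mult a (reverse xs ++ x ∷ [])          ≡⟨ mult-++ a (reverse xs) (x ∷ []) ⟩
  mult a (reverse xs) + mult a (x ∷ [])  ≡⟨ cong (_+ mult a (x ∷ [])) (mult-reverse a xs) ⟩
  mult a xs + mult a (x ∷ [])            ≡⟨ +-comm (mult a xs) _ ⟩
  mult a (x ∷ []) + mult a xs            ≡⟨ mult-∷ a x xs ⟨
  mult a (x ∷ xs)                        ∎
  where open ≡-Reasoning

mult-replicate-≢ : ∀ {a b} → a ≢ b → ∀ n xs → mult a (replicate n b ++ xs) ≡ mult a xs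
mult-replicate-≢ a≢b zero    xs = refl
mult-replicate-≢ a≢b (suc n) xs = trans (mult-there a≢b (replicate n _ ++ xs)) (mult-replicate-≢ a≢b n xs)

deals-mult : ∀ ws → All (λ (as , bs) → ∀ a → mult a as + mult a bs ≡ mult a ws) (deals ws)
deals-mult []       = (λ _ → refl) ∷ []
deals-mult (w ∷ ws) =
  AllP.++⁺ (AllP.map⁺ (All.map (λ {(as , bs)} → left as bs) (deals-mult ws)))
           (AllP.map⁺ (All.map (λ {(as , bs)} → right as bs) (deals-mult ws)))
  where
  open ≡-Reasoning
  left : ∀ as bs → (∀ a → mult a as + mult a bs ≡ mult a ws) →
         ∀ a → mult a (w ∷ as) + mult a bs ≡ mult a (w ∷ ws)
  left as bs eq a = begin
    mult a (w ∷ as) + mult a bs                 ≡⟨ cong (_+ mult a bs) (mult-∷ a w as) ⟩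
    mult a (w ∷ []) + mult a as + mult a bs     ≡⟨ +-assoc (mult a (w ∷ [])) _ _ ⟩
    mult a (w ∷ []) + (mult a as + mult a bs)   ≡⟨ cong (mult a (w ∷ []) +_) (eq a) ⟩
    mult a (w ∷ []) + mult a ws                 ≡⟨ mult-∷ a w ws ⟨
    mult a (w ∷ ws)                             ∎
  right : ∀ as bs → (∀ a → mult a as + mult a bs ≡ mult a ws) →
          ∀ a → mult a as + mult a (w ∷ bs) ≡ mult a (w ∷ ws)
  right as bs eq a = begin
    mult a as + mult a (w ∷ bs)  ≡⟨ +-comm (mult a as) _ ⟩
    mult a (w ∷ bs) + mult a as  ≡⟨ left bs as (λ b → trans (+-comm (mult b bs) _) (eq b)) a ⟩
    mult a (w ∷ ws)              ∎

-- Dealing a word to blocks with prescribed sums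

-- The blocks are reversed because γ lands in the reverse of ℕ_ℕ, so that
-- elements with equal value of f appear in decreasing order.
blockSum : List ℕ → List ℕ → (List ℕ → ℕ) → ℕ
blockSum []      ws H = 𝟙 (null ws) * H []
blockSum (d ∷ δ) ws H =
  ∑ (deals ws) (λ (as , bs) → 𝟙 (sum (reverse as) ≡ᵇ d) * blockSum δ bs (λ cs → H (reverse as ++ cs)))

blockSum-cong : ∀ δ ws {H H′ : List ℕ → ℕ} → (∀ cs → H cs ≡ H′ cs) → blockSum δ ws H ≡ blockSum δ ws H′
blockSum-cong []      ws eq = cong (𝟙 (null ws) *_) (eq [])
blockSum-cong (d ∷ δ) ws eq =
  ∑-cong (deals ws) λ (as , bs) →
    cong (𝟙 (sum (reverse as) ≡ᵇ d) *_) (blockSum-cong δ bs λ cs → eq (reverse as ++ cs))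

private
  *-leftComm : ∀ a b c → a * (b * c) ≡ b * (a * c)
  *-leftComm = solve-∀

blockSum-*ˡ : ∀ δ ws k (H : List ℕ → ℕ) → blockSum δ ws (λ cs → k * H cs) ≡ k * blockSum δ ws H
blockSum-*ˡ []      ws k H = *-leftComm (𝟙 (null ws)) k (H [])
blockSum-*ˡ (d ∷ δ) ws k H =
  trans (∑-cong (deals ws) λ (as , bs) →
           trans (cong (𝟙 (sum (reverse as) ≡ᵇ d) *_) (blockSum-*ˡ δ bs k _))
                 (*-leftComm (𝟙 (sum (reverse as) ≡ᵇ d)) k _))
        (∑-*ˡ (deals ws) k _)

blockSum-*ʳ : ∀ δ ws k (H : List ℕ → ℕ) → blockSum δ ws (λ cs → H cs * k) ≡ blockSum δ ws H * k
blockSum-*ʳ δ ws k H =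
  trans (blockSum-cong δ ws λ cs → *-comm (H cs) k) (trans (blockSum-*ˡ δ ws k H) (*-comm k _))

blockSum-∑ : ∀ δ ws (xs : List A) (H : A → List ℕ → ℕ) →
             blockSum δ ws (λ cs → ∑ xs (λ x → H x cs)) ≡ ∑ xs (λ x → blockSum δ ws (H x))
blockSum-∑ []      ws xs H = sym (∑-*ˡ xs (𝟙 (null ws)) _)
blockSum-∑ (d ∷ δ) ws xs H =
  trans (∑-cong (deals ws) λ (as , bs) →
           trans (cong (𝟙 (sum (reverse as) ≡ᵇ d) *_) (blockSum-∑ δ bs xs _))
                 (sym (∑-*ˡ xs (𝟙 (sum (reverse as) ≡ᵇ d)) _)))
        (∑-swap (deals ws) xs _)

-- Coassociativity moves the cut: dealing off the first block and then cutting the rest into two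
-- hands amounts to cutting first and dealing that block out of the left hand.
blockSum-++ : ∀ δ ε ws (H : List ℕ → ℕ) →
  blockSum (δ ++ ε) ws H ≡
  ∑ (deals ws) (λ (as , bs) → blockSum δ as (λ a → blockSum ε bs (λ b → H (a ++ b))))
blockSum-++ []      ε ws H = sym (∑-deals-identityˡ ws (λ bs → blockSum ε bs H))
blockSum-++ (d ∷ δ) ε ws H = begin
  ∑ (deals ws) (λ (as , cs) → 𝟙? as * blockSum (δ ++ ε) cs (λ c → H (reverse as ++ c)))
    ≡⟨ ∑-cong (deals ws) (λ (as , cs) → trans
         (cong (𝟙? as *_) (trans (blockSum-++ δ ε cs _)
            (∑-cong (deals cs) λ (a₂ , bs) → blockSum-cong δ a₂ λ a → blockSum-cong ε bs λ b →
               cong H (sym (++-assoc (reverse as) a b)))))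
         (sym (∑-*ˡ (deals cs) (𝟙? as) _))) ⟩
  ∑ (deals ws) (λ (as , cs) → ∑ (deals cs) (λ (a₂ , bs) → K as a₂ bs))
    ≡⟨ ∑-deals-assoc ws K ⟨
  ∑ (deals ws) (λ (as , bs) → ∑ (deals as) (λ (a₁ , a₂) → K a₁ a₂ bs)) ∎
  where
  open ≡-Reasoning
  𝟙? : List ℕ → ℕ
  𝟙? as = 𝟙 (sum (reverse as) ≡ᵇ d)
  K : List ℕ → List ℕ → List ℕ → ℕ
  K as a₂ bs = 𝟙? as * blockSum δ a₂ (λ a → blockSum ε bs (λ b → H ((reverse as ++ a) ++ b)))

-- `H` is evaluated only at readings of the blocks, and these are rearrangements of `ws`, since
-- dealing and reversing preserve multiplicities.
blockSum-zero : ∀ δ ws (H : List ℕ → ℕ) →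
                (∀ cs → (∀ a → mult a cs ≡ mult a ws) → H cs ≡ 0) → blockSum δ ws H ≡ 0
blockSum-zero []      []       H H≡0 = trans (*-identityˡ (H [])) (H≡0 [] λ _ → refl)
blockSum-zero []      (w ∷ ws) H H≡0 = refl
blockSum-zero (d ∷ δ) ws       H H≡0 =
  trans (∑-congAll (deals ws) (All.map (λ {(as , bs)} → vanish as bs) (deals-mult ws))) (∑-zero (deals ws))
  where
  open ≡-Reasoning
  vanish : ∀ as bs → (∀ a → mult a as + mult a bs ≡ mult a ws) →
    𝟙 (sum (reverse as) ≡ᵇ d) * blockSum δ bs (λ cs → H (reverse as ++ cs)) ≡ 0
  vanish as bs eq = trans
    (cong (𝟙 (sum (reverse as) ≡ᵇ d) *_)
      (blockSum-zero δ bs (λ cs → H (reverse as ++ cs)) λ cs cs~bs → H≡0 (reverse as ++ cs) λ a → begin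
        mult a (reverse as ++ cs)            ≡⟨ mult-++ a (reverse as) cs ⟩
        mult a (reverse as) + mult a cs      ≡⟨ cong₂ _+_ (mult-reverse a as) (cs~bs a) ⟩
        mult a as + mult a bs                ≡⟨ eq a ⟩
        mult a ws                            ∎))
    (*-zeroʳ (𝟙 (sum (reverse as) ≡ᵇ d)))

-- Equality tests and the cuts of a composition

eqᵇ : List ℕ → List ℕ → Bool
eqᵇ xs ys = does (≡-dec _≟_ xs ys)

eqᵇ-∷ : ∀ x y xs ys → 𝟙 (eqᵇ (x ∷ xs) (y ∷ ys)) ≡ 𝟙 (does (x ≟ y)) * 𝟙 (eqᵇ xs ys)
eqᵇ-∷ x y xs ys = 𝟙-∧ (does (x ≟ y)) (eqᵇ xs ys)

-- Different cuts have first parts of different lengths, so at most one term is nonzero: the cut of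
-- `α` after `length xs` letters.
∑-splits : ∀ xs ys α →
  𝟙 (eqᵇ (xs ++ ys) α) ≡ ∑ (splits α) (λ (β , γ) → 𝟙 (eqᵇ xs β) * 𝟙 (eqᵇ ys γ))
∑-splits []       ys []      = sym (trans (+-identityʳ _) (*-identityˡ _))
∑-splits []       ys (a ∷ α) = begin
  𝟙 (eqᵇ ys (a ∷ α))
    ≡⟨ +-identityʳ _ ⟨
  𝟙 (eqᵇ ys (a ∷ α)) + 0
    -- Only the cut with empty first part survives; in all others the first part begins with `a`.
    ≡⟨ cong₂ _+_ (sym (*-identityˡ _)) (sym (trans (∑-map (map₁ (a ∷_)) (splits α) _) (∑-zero (splits α)))) ⟩
  _ ∎
  where open ≡-Reasoning
∑-splits (x ∷ xs) ys []      = refl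
∑-splits (x ∷ xs) ys (a ∷ α) = begin
  𝟙 (eqᵇ (x ∷ xs ++ ys) (a ∷ α))
    ≡⟨ eqᵇ-∷ x a (xs ++ ys) α ⟩
  𝟙 (does (x ≟ a)) * 𝟙 (eqᵇ (xs ++ ys) α)
    ≡⟨ cong (𝟙 (does (x ≟ a)) *_) (∑-splits xs ys α) ⟩
  𝟙 (does (x ≟ a)) * ∑ (splits α) (λ (β , γ) → 𝟙 (eqᵇ xs β) * 𝟙 (eqᵇ ys γ))
    ≡⟨ ∑-*ˡ (splits α) (𝟙 (does (x ≟ a))) _ ⟨
  ∑ (splits α) (λ (β , γ) → 𝟙 (does (x ≟ a)) * (𝟙 (eqᵇ xs β) * 𝟙 (eqᵇ ys γ)))
    ≡⟨ ∑-cong (splits α) (λ (β , γ) → trans (sym (*-assoc (𝟙 (does (x ≟ a))) _ _))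
         (cong (_* 𝟙 (eqᵇ ys γ)) (sym (eqᵇ-∷ x a xs β)))) ⟩
  ∑ (splits α) (λ (β , γ) → 𝟙 (eqᵇ (x ∷ xs) (a ∷ β)) * 𝟙 (eqᵇ ys γ))
    ≡⟨ ∑-map (map₁ (a ∷_)) (splits α) _ ⟨
  _ ∎
  where open ≡-Reasoning

splits-++ : (xs : List A) → All (λ (ys , zs) → ys ++ zs ≡ xs) (splits xs)
splits-++ []       = refl ∷ []
splits-++ (x ∷ xs) = refl ∷ AllP.map⁺ (All.map (cong (x ∷_)) (splits-++ xs))

-- Counting the deals of a sorted word

-- Letters and multiplicities are separate arguments so that the words for `β`, `γ` and `β ++ γ` can
-- be written over one common list of letters.
sortedWord : List ℕ → (ℕ → ℕ) → List ℕ
sortedWord ks μ = concatMap (λ a → replicate (μ a) a) ks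

private
  -- Pascal's rule with cleared denominators: `x` and `y` are the sums with the next letter dealt
  -- left and right, `m` is (p+q+1)!, and `(suc p + suc q) * m` is (p+q+2)!.
  pascal : ∀ p q x y m X →
    x * (p ! * suc q !) ≡ m * X → y * (suc p ! * q !) ≡ m * X →
    (x + y) * (suc p ! * suc q !) ≡ (suc p + suc q) * m * X
  pascal p q x y m X ex ey = begin
    (x + y) * (suc p ! * suc q !)
      ≡⟨ l₁ x y (p !) (q !) p q ⟩
    suc p * (x * (p ! * suc q !)) + suc q * (y * (suc p ! * q !))
      ≡⟨ cong₂ (λ s t → suc p * s + suc q * t) ex ey ⟩
    suc p * (m * X) + suc q * (m * X)
      ≡⟨ l₂ p q m X ⟩
    (suc p + suc q) * m * X ∎
    where
    open ≡-Reasoning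
    l₁ : ∀ x y P Q p q → (x + y) * ((P + p * P) * (Q + q * Q)) ≡
      (1 + p) * (x * (P * (Q + q * Q))) + (1 + q) * (y * ((P + p * P) * Q))
    l₁ = solve-∀
    l₂ : ∀ p q m X → (1 + p) * (m * X) + (1 + q) * (m * X) ≡ (1 + p + (1 + q)) * m * X
    l₂ = solve-∀

-- A deal of the leading block that does not send `p` copies left and `q` right overfills one hand
-- and is killed by the support conditions. The binom(p+q, p) others all put the same letters in
-- front of the hands.
∑-deals-replicate : ∀ a p q ws (K : List ℕ × List ℕ → ℕ) →
  (∀ as bs → mult a as ≢ p → K (as , bs) ≡ 0) →
  (∀ as bs → mult a bs ≢ q → K (as , bs) ≡ 0) →
  ∑ (deals (replicate (p + q) a ++ ws)) K * (p ! * q !) ≡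
  (p + q) ! * ∑ (deals ws) (λ (as , bs) → K (replicate p a ++ as , replicate q a ++ bs))
∑-deals-replicate a zero zero ws K K₁ K₂ = *-comm (∑ (deals ws) K) 1
∑-deals-replicate a (suc p) zero ws K K₁ K₂ = begin
  ∑ (deals (a ∷ ws′)) K * (suc p ! * 1)
    -- The right hand may hold no `a`, so dealing the next `a` there makes `K` vanish.
    ≡⟨ cong (_* (suc p ! * 1)) (trans (∑-deals-∷ a ws′ K) (trans
         (cong (∑ (deals ws′) (K ∘ map₁ (a ∷_)) +_) (trans (∑-cong (deals ws′) λ (as , bs) →
            K₂ as (a ∷ bs) λ e → 1+n≢0 (trans (sym (mult-here a bs)) e)) (∑-zero (deals ws′))))
         (+-identityʳ _))) ⟩
  x * (suc p ! * 1)
    ≡⟨ lemma x (p !) p ⟩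
  suc p * (x * (p ! * 1))
    ≡⟨ cong (suc p *_) (∑-deals-replicate a p zero ws (K ∘ map₁ (a ∷_))
         (λ as bs ≢p → K₁ (a ∷ as) bs λ e → ≢p (suc-injective (trans (sym (mult-here a as)) e)))
         (λ as → K₂ (a ∷ as))) ⟩
  suc p * ((p + 0) ! * X)
    ≡⟨ *-assoc (suc p) ((p + 0) !) X ⟨
  suc p * (p + 0) ! * X
    ≡⟨ cong (λ n → suc n * (p + 0) ! * X) (+-identityʳ p) ⟨
  (suc p + 0) ! * X ∎
  where
  open ≡-Reasoning
  ws′ = replicate (p + 0) a ++ ws
  x = ∑ (deals ws′) (K ∘ map₁ (a ∷_))
  X = ∑ (deals ws) (λ (as , bs) → K (replicate (suc p) a ++ as , bs))
  lemma : ∀ x P p → x * ((P + p * P) * 1) ≡ (1 + p) * (x * (P * 1))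
  lemma = solve-∀
∑-deals-replicate a zero (suc q) ws K K₁ K₂ = begin
  ∑ (deals (a ∷ ws′)) K * (1 * suc q !)
    ≡⟨ cong (_* (1 * suc q !)) (trans (∑-deals-∷ a ws′ K)
         (cong (_+ ∑ (deals ws′) (K ∘ map₂ (a ∷_))) (trans (∑-cong (deals ws′) λ (as , bs) →
            K₁ (a ∷ as) bs λ e → 1+n≢0 (trans (sym (mult-here a as)) e)) (∑-zero (deals ws′))))) ⟩
  y * (1 * suc q !)
    ≡⟨ lemma y (q !) q ⟩
  suc q * (y * (1 * q !))
    ≡⟨ cong (suc q *_) (∑-deals-replicate a zero q ws (K ∘ map₂ (a ∷_))
         (λ as bs → K₁ as (a ∷ bs))
         (λ as bs ≢q → K₂ as (a ∷ bs) λ e → ≢q (suc-injective (trans (sym (mult-here a bs)) e)))) ⟩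
  suc q * (q ! * X)
    ≡⟨ *-assoc (suc q) (q !) X ⟨
  suc q ! * X ∎
  where
  open ≡-Reasoning
  ws′ = replicate q a ++ ws
  y = ∑ (deals ws′) (K ∘ map₂ (a ∷_))
  X = ∑ (deals ws) (λ (as , bs) → K (as , replicate (suc q) a ++ bs))
  lemma : ∀ y Q q → y * (1 * (Q + q * Q)) ≡ (1 + q) * (y * (1 * Q))
  lemma = solve-∀
∑-deals-replicate a (suc p) (suc q) ws K K₁ K₂ = begin
  ∑ (deals (a ∷ ws′)) K * (suc p ! * suc q !)
    ≡⟨ cong (_* (suc p ! * suc q !)) (∑-deals-∷ a ws′ K) ⟩
  (x + y) * (suc p ! * suc q !)
    ≡⟨ pascal p q x y ((p + suc q) !) X
         (∑-deals-replicate a p (suc q) ws (K ∘ map₁ (a ∷_))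
           (λ as bs ≢p → K₁ (a ∷ as) bs λ e → ≢p (suc-injective (trans (sym (mult-here a as)) e)))
           (λ as → K₂ (a ∷ as)))
         (subst (λ n → ∑ (deals (replicate n a ++ ws)) (K ∘ map₂ (a ∷_)) * (suc p ! * q !) ≡ n ! * X)
           (sym (+-suc p q))
           (∑-deals-replicate a (suc p) q ws (K ∘ map₂ (a ∷_))
             (λ as bs → K₁ as (a ∷ bs))
             (λ as bs ≢q → K₂ as (a ∷ bs) λ e → ≢q (suc-injective (trans (sym (mult-here a bs)) e))))) ⟩
  (suc p + suc q) ! * X ∎
  where
  open ≡-Reasoning
  ws′ = replicate (p + suc q) a ++ ws
  x = ∑ (deals ws′) (K ∘ map₁ (a ∷_))
  y = ∑ (deals ws′) (K ∘ map₂ (a ∷_))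
  X = ∑ (deals ws) (λ (as , bs) → K (replicate (suc p) a ++ as , replicate (suc q) a ++ bs))

zProd : List ℕ → (ℕ → ℕ) → ℕ
zProd ks μ = product (map (λ a → a ^ μ a * μ a !) ks)

-- One letter at a time: `∑-deals-replicate` supplies the factorials and the powers of `a` add up.
-- As `ks` has no repetitions, removing the block of `a` leaves the multiplicities of the later
-- letters alone, so the support conditions pass to the rest.
∑-deals-sortedWord : ∀ ks → Unique ks → ∀ p q (K : List ℕ × List ℕ → ℕ) →
  (∀ as bs → ¬ All (λ a → mult a as ≡ p a) ks → K (as , bs) ≡ 0) →
  (∀ as bs → ¬ All (λ a → mult a bs ≡ q a) ks → K (as , bs) ≡ 0) →
  ∑ (deals (sortedWord ks (λ a → p a + q a))) K * (zProd ks p * zProd ks q) ≡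
  zProd ks (λ a → p a + q a) * K (sortedWord ks p , sortedWord ks q)
∑-deals-sortedWord []       _             p q K K₁ K₂ = lemma (K ([] , []))
  where
  lemma : ∀ k → (k + 0) * 1 ≡ 1 * k
  lemma = solve-∀
∑-deals-sortedWord (a ∷ ks) (a∉ks ∷ uniq) p q K K₁ K₂ = begin
  S * ((a ^ p a * p a ! * P) * (a ^ q a * q a ! * Q))
    ≡⟨ lemma₁ S (a ^ p a) (p a !) P (a ^ q a) (q a !) Q ⟩
  a ^ p a * a ^ q a * (S * (p a ! * q a !)) * (P * Q)
    ≡⟨ cong₂ (λ s t → s * t * (P * Q)) (sym (^-distribˡ-+-* a (p a) (q a)))
         (∑-deals-replicate a (p a) (q a) ws K
           (λ as bs ≢p → K₁ as bs (≢p ∘ All.head)) (λ as bs ≢q → K₂ as bs (≢q ∘ All.head))) ⟩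
  a ^ r * (r ! * S′) * (P * Q)
    ≡⟨ lemma₂ (a ^ r) (r !) S′ (P * Q) ⟩
  a ^ r * r ! * (S′ * (P * Q))
    ≡⟨ cong (a ^ r * r ! *_) (∑-deals-sortedWord ks uniq p q
         (λ (as , bs) → K (replicate (p a) a ++ as , replicate (q a) a ++ bs))
         (λ as bs ¬p → K₁ _ _ (¬p ∘ strip (p a) p as ∘ All.tail))
         (λ as bs ¬q → K₂ _ _ (¬q ∘ strip (q a) q bs ∘ All.tail))) ⟩
  a ^ r * r ! * (zProd ks (λ a → p a + q a) * k)
    ≡⟨ *-assoc (a ^ r * r !) _ _ ⟨
  a ^ r * r ! * zProd ks (λ a → p a + q a) * k ∎
  where
  open ≡-Reasoning
  r = p a + q a
  P = zProd ks p
  Q = zProd ks q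
  ws = sortedWord ks (λ a → p a + q a)
  S = ∑ (deals (replicate r a ++ ws)) K
  S′ = ∑ (deals ws) (λ (as , bs) → K (replicate (p a) a ++ as , replicate (q a) a ++ bs))
  k = K (sortedWord (a ∷ ks) p , sortedWord (a ∷ ks) q)
  lemma₁ : ∀ s a b c d e f → s * ((a * b * c) * (d * e * f)) ≡ a * d * (s * (b * e)) * (c * f)
  lemma₁ = solve-∀
  lemma₂ : ∀ a b c d → a * (b * c) * d ≡ a * b * (c * d)
  lemma₂ = solve-∀
  strip : ∀ n μ xs → All (λ b → mult b (replicate n a ++ xs) ≡ μ b) ks → All (λ b → mult b xs ≡ μ b) ks
  strip n μ xs eqs = All.zipWith
    (λ (a≢b , e) → trans (sym (mult-replicate-≢ (a≢b ∘ sym) n xs)) e) (a∉ks , eqs)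

-- Letters beyond the largest part

maxPart-++ : ∀ β γ → maxPart (β ++ γ) ≡ maxPart β ⊔ maxPart γ
maxPart-++ []      γ = refl
maxPart-++ (b ∷ β) γ = trans (cong (b ⊔_) (maxPart-++ β γ)) (sym (⊔-assoc b _ _))

mult-maxPart : ∀ {a} β → maxPart β < a → mult a β ≡ 0
mult-maxPart     []      _  = refl
mult-maxPart {a} (b ∷ β) lt =
  trans (mult-there (λ a≡b → <-irrefl (sym a≡b) (≤-<-trans (m≤m⊔n b _) lt)) β)
        (mult-maxPart β (≤-<-trans (m≤n⊔m b _) lt))

range1-∷ʳ : ∀ n → range1 (suc n) ≡ range1 n ++ suc n ∷ []
range1-∷ʳ n = trans (cong (map suc) (sym (upTo-∷ʳ n))) (map-++ suc (upTo n) (n ∷ []))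

range1-unique : ∀ n → Unique (range1 n)
range1-unique n = UniqueP.map⁺ suc-injective (UniqueP.upTo⁺ n)

module _ (β : List ℕ) where

  private
    μ : ℕ → ℕ
    μ a = mult a β

    step : ∀ n → maxPart β ≤ n → μ (suc n) ≡ 0
    step n le = mult-maxPart β (s≤s le)

  -- Allows `β` and `γ` to share the range of letters of `β ++ γ`: a letter beyond `maxPart β` has
  -- multiplicity 0 and gives an empty block.
  sortedWord-range1 : ∀ k → sortedWord (range1 (k + maxPart β)) μ ≡ sortedWord (range1 (maxPart β)) μ
  sortedWord-range1 zero    = refl
  sortedWord-range1 (suc k) = begin
    sortedWord (range1 (suc N)) μ
      ≡⟨ cong (λ ks → sortedWord ks μ) (range1-∷ʳ N) ⟩
    sortedWord (range1 N ++ suc N ∷ []) μ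
      ≡⟨ concatMap-++ (λ a → replicate (μ a) a) (range1 N) (suc N ∷ []) ⟩
    sortedWord (range1 N) μ ++ replicate (μ (suc N)) (suc N) ++ []
      ≡⟨ cong (λ r → sortedWord (range1 N) μ ++ replicate r (suc N) ++ []) (step N (m≤n+m _ k)) ⟩
    sortedWord (range1 N) μ ++ []
      ≡⟨ ++-identityʳ _ ⟩
    sortedWord (range1 N) μ
      ≡⟨ sortedWord-range1 k ⟩
    sortedWord (range1 (maxPart β)) μ ∎
    where
    open ≡-Reasoning
    N = k + maxPart β

  -- A letter a beyond `maxPart β` contributes the factor a^0 · 0! = 1.
  zProd-range1 : ∀ k → zProd (range1 (k + maxPart β)) μ ≡ z β
  zProd-range1 zero    = refl
  zProd-range1 (suc k) = begin
    zProd (range1 (suc N)) μ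
      ≡⟨ cong (λ ks → zProd ks μ) (range1-∷ʳ N) ⟩
    zProd (range1 N ++ suc N ∷ []) μ
      ≡⟨ cong product (map-++ (zTerm β) (range1 N) (suc N ∷ [])) ⟩
    product (map (zTerm β) (range1 N) ++ zTerm β (suc N) ∷ [])
      ≡⟨ product-++ (map (zTerm β) (range1 N)) (zTerm β (suc N) ∷ []) ⟩
    zProd (range1 N) μ * (zTerm β (suc N) * 1)
      ≡⟨ cong (λ r → zProd (range1 N) μ * (suc N ^ r * r ! * 1)) (step N (m≤n+m _ k)) ⟩
    zProd (range1 N) μ * 1
      ≡⟨ *-identityʳ _ ⟩
    zProd (range1 N) μ
      ≡⟨ zProd-range1 k ⟩
    z β ∎
    where
    open ≡-Reasoning
    N = k + maxPart β

-- Block coefficients and their factorisation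

𝟙-eqᵇ-≢ : ∀ {xs ys} → xs ≢ ys → 𝟙 (eqᵇ xs ys) ≡ 0
𝟙-eqᵇ-≢ {xs} {ys} xs≢ys with ≡-dec _≟_ xs ys
... | yes xs≡ys = ⊥-elim (xs≢ys xs≡ys)
... | no  _     = refl

weights : List ℕ → List ℕ
weights α = sortedWord (range1 (maxPart α)) (λ a → mult a α)

-- The dealt word `ws` is separate from `α` because a hand may fail to be a rearrangement of the
-- index it is tested against. At `weights α` the value is the coefficient of M_δ in 𝓅_α.
blockCoeff : List ℕ → List ℕ → List ℕ → ℕ
blockCoeff α δ ws = blockSum δ ws (λ cs → 𝟙 (eqᵇ cs α))

blockCoeff-zero : ∀ β δ ks ws → ¬ All (λ a → mult a ws ≡ mult a β) ks → blockCoeff β δ ws ≡ 0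
blockCoeff-zero β δ ks ws ≁ = blockSum-zero δ ws _ λ cs cs~ws →
  𝟙-eqᵇ-≢ {cs} {β} λ cs≡β → ≁ (All.universal (λ a → trans (sym (cs~ws a)) (cong (mult a) cs≡β)) ks)

-- The source of z_α / (z_β z_γ): the summand is supported on hands with the multiplicities of `β`
-- and `γ`, so `∑-deals-sortedWord` applies once all words and all `z` are written over the letters
-- up to `maxPart (β ++ γ)`.
weights-deals : ∀ β γ δ ε →
  ∑ (deals (weights (β ++ γ))) (λ (as , bs) → blockCoeff β δ as * blockCoeff γ ε bs) * (z β * z γ) ≡
  z (β ++ γ) * (blockCoeff β δ (weights β) * blockCoeff γ ε (weights γ))
weights-deals β γ δ ε = begin
  ∑ (deals (weights (β ++ γ))) K * (z β * z γ)
    ≡⟨ cong₂ (λ ws n → ∑ (deals ws) K * n)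
         (concatMap-cong (λ a → cong (λ n → replicate n a) (mult-++ a β γ)) ks)
         (sym (cong₂ _*_ (zProd-ks β β≤) (zProd-ks γ γ≤))) ⟩
  ∑ (deals (sortedWord ks (λ a → mult a β + mult a γ))) K *
    (zProd ks (λ a → mult a β) * zProd ks (λ a → mult a γ))
    ≡⟨ ∑-deals-sortedWord ks (range1-unique N) (λ a → mult a β) (λ a → mult a γ) K
         (λ as bs ≁ → cong (_* blockCoeff γ ε bs) (blockCoeff-zero β δ ks as ≁))
         (λ as bs ≁ → trans (cong (blockCoeff β δ as *_) (blockCoeff-zero γ ε ks bs ≁))
                            (*-zeroʳ (blockCoeff β δ as))) ⟩
  zProd ks (λ a → mult a β + mult a γ) *
    K (sortedWord ks (λ a → mult a β) , sortedWord ks (λ a → mult a γ))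
    ≡⟨ cong₂ (λ n p → n * K p)
         (cong product (map-cong (λ a → cong (λ n → a ^ n * n !) (sym (mult-++ a β γ))) ks))
         (cong₂ _,_ (word-ks β β≤) (word-ks γ γ≤)) ⟩
  z (β ++ γ) * (blockCoeff β δ (weights β) * blockCoeff γ ε (weights γ)) ∎
  where
  open ≡-Reasoning
  N = maxPart (β ++ γ)
  ks = range1 N
  K : List ℕ × List ℕ → ℕ
  K (as , bs) = blockCoeff β δ as * blockCoeff γ ε bs
  β≤ : maxPart β ≤ N
  β≤ = ≤-trans (m≤m⊔n (maxPart β) (maxPart γ)) (≤-reflexive (sym (maxPart-++ β γ)))
  γ≤ : maxPart γ ≤ N
  γ≤ = ≤-trans (m≤n⊔m (maxPart β) (maxPart γ)) (≤-reflexive (sym (maxPart-++ β γ)))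
  word-ks : ∀ ξ → maxPart ξ ≤ N → sortedWord ks (λ a → mult a ξ) ≡ weights ξ
  word-ks ξ le = trans (cong (λ n → sortedWord (range1 n) (λ a → mult a ξ)) (sym (m∸n+n≡m le)))
                       (sortedWord-range1 ξ (N ∸ maxPart ξ))
  zProd-ks : ∀ ξ → maxPart ξ ≤ N → zProd ks (λ a → mult a ξ) ≡ z ξ
  zProd-ks ξ le = trans (cong (λ n → zProd (range1 n) (λ a → mult a ξ)) (sym (m∸n+n≡m le)))
                        (zProd-range1 ξ (N ∸ maxPart ξ))

-- The reading of all blocks is `a ++ b`, with `a` from the left hand and `b` from the right.
-- `∑-splits` distributes the test against `α` over its cuts, and for each cut the two readings are
-- summed independently.
blockCoeff-++ : ∀ α δ ε → blockCoeff α (δ ++ ε) (weights α) ≡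
  ∑ (splits α) (λ (β , γ) →
    ∑ (deals (weights α)) (λ (as , bs) → blockCoeff β δ as * blockCoeff γ ε bs))
blockCoeff-++ α δ ε = begin
  blockSum (δ ++ ε) (weights α) (λ cs → 𝟙 (eqᵇ cs α))
    ≡⟨ blockSum-++ δ ε (weights α) _ ⟩
  ∑ (deals (weights α)) (λ (as , bs) → blockSum δ as (λ a → blockSum ε bs (λ b → 𝟙 (eqᵇ (a ++ b) α))))
    ≡⟨ ∑-cong (deals (weights α)) (λ (as , bs) → split as bs) ⟩
  ∑ (deals (weights α)) (λ (as , bs) → ∑ (splits α) (λ (β , γ) → blockCoeff β δ as * blockCoeff γ ε bs))
    ≡⟨ ∑-swap (deals (weights α)) (splits α) _ ⟩
  _ ∎
  where
  open ≡-Reasoning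
  split : ∀ as bs → blockSum δ as (λ a → blockSum ε bs (λ b → 𝟙 (eqᵇ (a ++ b) α))) ≡
                    ∑ (splits α) (λ (β , γ) → blockCoeff β δ as * blockCoeff γ ε bs)
  split as bs = begin
    blockSum δ as (λ a → blockSum ε bs (λ b → 𝟙 (eqᵇ (a ++ b) α)))
      ≡⟨ blockSum-cong δ as (λ a → trans (blockSum-cong ε bs λ b → ∑-splits a b α)
           (trans (blockSum-∑ ε bs (splits α) _)
             (∑-cong (splits α) λ (β , γ) → blockSum-*ˡ ε bs (𝟙 (eqᵇ a β)) (λ cs → 𝟙 (eqᵇ cs γ))))) ⟩
    blockSum δ as (λ a → ∑ (splits α) (λ (β , γ) → 𝟙 (eqᵇ a β) * blockCoeff γ ε bs))
      ≡⟨ blockSum-∑ δ as (splits α) _ ⟩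
    ∑ (splits α) (λ (β , γ) → blockSum δ as (λ a → 𝟙 (eqᵇ a β) * blockCoeff γ ε bs))
      ≡⟨ ∑-cong (splits α) (λ (β , γ) → blockSum-*ʳ δ as _ _) ⟩
    ∑ (splits α) (λ (β , γ) → blockCoeff β δ as * blockCoeff γ ε bs) ∎

-- From natural numbers to rationals

+-/1 : ∀ m n → pos (m + n) / 1 ≡ (pos m / 1) +ℚ (pos n / 1)
+-/1 m n = ℚP.toℚᵘ-injective (begin
  toℚᵘ (pos (m + n) / 1)
    ≈⟨ ℚP.toℚᵘ-fromℚᵘ (mkℚᵘ (pos (m + n)) 0) ⟩
  mkℚᵘ (pos (m + n)) 0
    ≈⟨ *≡* (cong (ℤ._* pos 1) (cong₂ ℤ._+_ (ℤP.*-identityʳ (pos m)) (ℤP.*-identityʳ (pos n)))) ⟨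
  mkℚᵘ (pos m) 0 ℚᵘ.+ mkℚᵘ (pos n) 0
    ≈⟨ ℚᵘP.+-cong (ℚP.toℚᵘ-fromℚᵘ (mkℚᵘ (pos m) 0)) (ℚP.toℚᵘ-fromℚᵘ (mkℚᵘ (pos n) 0)) ⟨
  toℚᵘ (pos m / 1) ℚᵘ.+ toℚᵘ (pos n / 1)
    ≈⟨ ℚP.toℚᵘ-homo-+ (pos m / 1) (pos n / 1) ⟨
  toℚᵘ ((pos m / 1) +ℚ (pos n / 1)) ∎)
  where open ℚᵘP.≃-Reasoning

-- `_/_` reduces fractions, so the equation is checked among unnormalised rationals, where it is
-- cross multiplication.
/1-cross : ∀ s n d m p .{{_ : NonZero d}} → s * d ≡ n * (m * p) →
           pos s / 1 ≡ (pos n / d) *ℚ ((pos m / 1) *ℚ (pos p / 1))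
/1-cross s n (suc d) m p eq = ℚP.toℚᵘ-injective (begin
  toℚᵘ (pos s / 1)
    ≈⟨ ℚP.toℚᵘ-fromℚᵘ (mkℚᵘ (pos s) 0) ⟩
  mkℚᵘ (pos s) 0
    ≈⟨ *≡* cross ⟩
  -- `mkℚᵘ` stores the denominator minus one: `d` stands for `suc d`, and 0 for the denominator 1.
  mkℚᵘ (pos n) d ℚᵘ.* (mkℚᵘ (pos m) 0 ℚᵘ.* mkℚᵘ (pos p) 0)
    ≈⟨ ℚᵘP.*-cong (ℚP.toℚᵘ-fromℚᵘ (mkℚᵘ (pos n) d))
         (ℚᵘP.*-cong (ℚP.toℚᵘ-fromℚᵘ (mkℚᵘ (pos m) 0)) (ℚP.toℚᵘ-fromℚᵘ (mkℚᵘ (pos p) 0))) ⟨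
  toℚᵘ (pos n / suc d) ℚᵘ.* (toℚᵘ (pos m / 1) ℚᵘ.* toℚᵘ (pos p / 1))
    ≈⟨ ℚᵘP.*-congˡ {toℚᵘ (pos n / suc d)} (ℚP.toℚᵘ-homo-* (pos m / 1) (pos p / 1)) ⟨
  toℚᵘ (pos n / suc d) ℚᵘ.* toℚᵘ ((pos m / 1) *ℚ (pos p / 1))
    ≈⟨ ℚP.toℚᵘ-homo-* (pos n / suc d) _ ⟨
  toℚᵘ ((pos n / suc d) *ℚ ((pos m / 1) *ℚ (pos p / 1))) ∎)
  where
  open ℚᵘP.≃-Reasoning
  cross : pos s ℤ.* pos (suc d * 1) ≡ pos n ℤ.* (pos m ℤ.* pos p) ℤ.* pos 1
  cross = trans (cong (λ k → pos s ℤ.* pos k) (*-identityʳ (suc d)))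
    (trans (sym (ℤP.pos-* s (suc d)))
    (trans (cong pos eq)
    (trans (ℤP.pos-* n (m * p))
    (trans (cong (pos n ℤ.*_) (ℤP.pos-* m p)) (sym (ℤP.*-identityʳ _))))))

-- Sums over finite index sets and vectors

allFin-suc : ∀ n → allFin (suc n) ≡ zero ∷ map suc (allFin n)
allFin-suc n = cong (zero ∷_) (sym (map-tabulate id suc))

∑-allFin-suc : ∀ n (h : Fin (suc n) → ℕ) → ∑ (allFin (suc n)) h ≡ h zero + ∑ (allFin n) (h ∘ suc)
∑-allFin-suc n h = trans (cong (λ is → ∑ is h) (allFin-suc n)) (cong (h zero +_) (∑-map suc (allFin n) h))

∑-allVecs-suc : ∀ m n (h : Vec (Fin m) (suc n) → ℕ) →
                ∑ (allVecs m (suc n)) h ≡ ∑ (allFin m) (λ x → ∑ (allVecs m n) (λ f → h (x ∷ f)))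
∑-allVecs-suc m n h =
  trans (∑-concatMap (λ x → map (x ∷_) (allVecs m n)) (allFin m) h)
        (∑-cong (allFin m) λ x → ∑-map (x ∷_) (allVecs m n) h)

∑-allFin-single : (h : Fin n → ℕ) (i : Fin n) → (∀ j → j ≢ i → h j ≡ 0) → ∑ (allFin n) h ≡ h i
∑-allFin-single {suc n} h zero    h≡0 =
  trans (∑-allFin-suc n h)
  (trans (cong (h zero +_) (trans (∑-cong (allFin n) λ j → h≡0 (suc j) λ ()) (∑-zero (allFin n))))
         (+-identityʳ (h zero)))
∑-allFin-single {suc n} h (suc i) h≡0 =
  trans (∑-allFin-suc n h)
        (cong₂ _+_ (h≡0 zero λ ()) (∑-allFin-single (h ∘ suc) i λ j j≢i →
           h≡0 (suc j) (j≢i ∘ FinP.suc-injective)))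

∑-allVecs-single : (h : Vec (Fin m) n → ℕ) (σ : Vec (Fin m) n) →
                   (∀ τ → τ ≢ σ → h τ ≡ 0) → ∑ (allVecs m n) h ≡ h σ
∑-allVecs-single h []       h≡0 = +-identityʳ (h [])
∑-allVecs-single {m} {suc n} h (x ∷ σ) h≡0 =
  trans (∑-allVecs-suc m n h)
  (trans (∑-allFin-single _ x λ y y≢x →
            trans (∑-cong (allVecs m n) λ τ → h≡0 (y ∷ τ) (y≢x ∘ VP.∷-injectiveˡ)) (∑-zero (allVecs m n)))
         (∑-allVecs-single (h ∘ (x ∷_)) σ λ τ τ≢σ → h≡0 (x ∷ τ) (τ≢σ ∘ VP.∷-injectiveʳ)))

-- Maps as distributions into blocks

-- Appending the head after the recursion leaves each block in the reverse order of `xs`, the order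
-- in which the chain of an (s,γ)-partition runs through a fibre.
blocks : Vec A n → Vec (Fin m) n → Vec (List A) m
blocks []       []      = V.replicate _ []
blocks (x ∷ xs) (v ∷ f) = V.updateAt (blocks xs f) v (_∷ʳ x)

concatV : Vec (List A) m → List A
concatV bs = concat (V.toList bs)

distSum : (m : ℕ) → List A → (Vec (List A) m → ℕ) → ℕ
distSum m []       H = H (V.replicate m [])
distSum m (w ∷ ws) H = ∑ (allFin m) (λ v → distSum m ws (λ bs → H (V.updateAt bs v (_∷ʳ w))))

∑-allVecs : (xs : Vec A n) (H : Vec (List A) m → ℕ) →
            ∑ (allVecs m n) (λ f → H (blocks xs f)) ≡ distSum m (V.toList xs) H
∑-allVecs []       H = +-identityʳ _
∑-allVecs {n = suc n} {m} (x ∷ xs) H =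
  trans (∑-allVecs-suc m n _)
        (∑-cong (allFin m) λ v → ∑-allVecs xs (λ bs → H (V.updateAt bs v (_∷ʳ x))))

distSum-cong : (ws : List A) {H H′ : Vec (List A) m → ℕ} → (∀ bs → H bs ≡ H′ bs) →
               distSum m ws H ≡ distSum m ws H′
distSum-cong         []       eq = eq _
distSum-cong {m = m} (w ∷ ws) eq = ∑-cong (allFin m) λ v → distSum-cong ws λ bs → eq _

distSum-*ˡ : (ws : List A) (k : ℕ) (H : Vec (List A) m → ℕ) →
             distSum m ws (λ bs → k * H bs) ≡ k * distSum m ws H
distSum-*ˡ         []       k H = refl
distSum-*ˡ {m = m} (w ∷ ws) k H =
  trans (∑-cong (allFin m) λ v → distSum-*ˡ ws k _) (∑-*ˡ (allFin m) k _)

-- Passes from choosing a block for each letter to choosing the letters of each block: those of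
-- block 0 form the left hand, and the rest go to the other `m` blocks. The hand is reversed because
-- later letters enter a block first.
distSum-suc : (ws : List A) (H : Vec (List A) (suc m) → ℕ) →
  distSum (suc m) ws H ≡ ∑ (deals ws) (λ (as , bs) → distSum m bs (λ bss → H (reverse as ∷ bss)))
distSum-suc         []       H = sym (+-identityʳ _)
distSum-suc {m = m} (w ∷ ws) H = begin
  ∑ (allFin (suc m)) (λ v → distSum (suc m) ws (λ bs → H (V.updateAt bs v (_∷ʳ w))))
    ≡⟨ ∑-allFin-suc m _ ⟩
  distSum (suc m) ws _ + ∑ (allFin m) (λ v → distSum (suc m) ws _)
    ≡⟨ cong₂ _+_ (distSum-suc ws _) (∑-cong (allFin m) λ v → distSum-suc ws _) ⟩
  ∑ (deals ws) (λ (as , bs) → distSum m bs (λ bss → H ((reverse as ∷ʳ w) ∷ bss))) +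
  ∑ (allFin m) (λ v → ∑ (deals ws) (λ (as , bs) →
    distSum m bs (λ bss → H (reverse as ∷ V.updateAt bss v (_∷ʳ w)))))
    ≡⟨ cong₂ _+_
         (∑-cong (deals ws) λ (as , bs) → distSum-cong bs λ bss →
            cong (λ b → H (b ∷ bss)) (sym (unfold-reverse w as)))
         (∑-swap (allFin m) (deals ws) _) ⟩
  ∑ (deals ws) (λ (as , bs) → distSum m bs (λ bss → H (reverse (w ∷ as) ∷ bss))) +
  ∑ (deals ws) (λ (as , bs) → distSum m (w ∷ bs) (λ bss → H (reverse as ∷ bss)))
    ≡⟨ ∑-deals-∷ w ws _ ⟨
  _ ∎
  where open ≡-Reasoning

sumsᵇ : (δ : List ℕ) → Vec (List ℕ) (length δ) → Bool
sumsᵇ []      []       = true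
sumsᵇ (d ∷ δ) (b ∷ bs) = (sum b ≡ᵇ d) ∧ sumsᵇ δ bs

distSum-blockSum : ∀ δ ws (H : List ℕ → ℕ) →
  distSum (length δ) ws (λ bs → 𝟙 (sumsᵇ δ bs) * H (concatV bs)) ≡ blockSum δ ws H
distSum-blockSum []      []       H = refl
distSum-blockSum []      (w ∷ ws) H = refl
distSum-blockSum (d ∷ δ) ws       H =
  trans (distSum-suc ws _) (∑-cong (deals ws) λ (as , bs) →
    trans (distSum-cong bs λ bss →
             trans (cong (_* H (reverse as ++ concatV bss)) (𝟙-∧ (sum (reverse as) ≡ᵇ d) (sumsᵇ δ bss)))
                   (*-assoc (𝟙 (sum (reverse as) ≡ᵇ d)) _ _))
    (trans (distSum-*ˡ bs (𝟙 (sum (reverse as) ≡ᵇ d)) _)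
           (cong (𝟙 (sum (reverse as) ≡ᵇ d) *_) (distSum-blockSum δ bs (λ cs → H (reverse as ++ cs))))))

allFinᵇ-suc : ∀ n (p : Fin (suc n) → Bool) → allFinᵇ (suc n) p ≡ p zero ∧ allFinᵇ n (p ∘ suc)
allFinᵇ-suc n p = cong (λ bs → foldr _∧_ true (p zero ∷ bs))
  (trans (map-tabulate suc p) (sym (map-tabulate id (p ∘ suc))))

allFinᵇ-cong : {p q : Fin n → Bool} → (∀ i → p i ≡ q i) → allFinᵇ n p ≡ allFinᵇ n q
allFinᵇ-cong {n} eq = cong (foldr _∧_ true) (map-cong eq (allFin n))

sumsᵇ-allFinᵇ : ∀ δ bs → sumsᵇ δ bs ≡ allFinᵇ (length δ) (λ v → sum (V.lookup bs v) ≡ᵇ L.lookup δ v)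
sumsᵇ-allFinᵇ []      []       = refl
sumsᵇ-allFinᵇ (d ∷ δ) (b ∷ bs) =
  trans (cong ((sum b ≡ᵇ d) ∧_) (sumsᵇ-allFinᵇ δ bs)) (sym (allFinᵇ-suc (length δ) _))

filterᵇ-map : (p : B → Bool) (g : A → B) (xs : List A) → filterᵇ p (map g xs) ≡ map g (filterᵇ (p ∘ g) xs)
filterᵇ-map p g []       = refl
filterᵇ-map p g (x ∷ xs) with p (g x)
... | true  = cong (g x ∷_) (filterᵇ-map p g xs)
... | false = filterᵇ-map p g xs

fibre : Vec (Fin m) n → Fin m → List (Fin n)
fibre {n = n} f v = filterᵇ (λ i → V.lookup f i ≡Finᵇ v) (allFin n)

-- Position `zero` is left as a filtered singleton, so that a case distinction on `toℕ u ≡ᵇ toℕ v`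
-- decides it.
fibre-∷ : (u : Fin m) (f : Vec (Fin m) n) (v : Fin m) →
  fibre (u ∷ f) v ≡ filterᵇ (λ i → V.lookup (u ∷ f) i ≡Finᵇ v) (zero ∷ []) ++ map suc (fibre f v)
fibre-∷ {n = n} u f v
  with toℕ u ≡ᵇ toℕ v
     | cong (filterᵇ (λ i → V.lookup (u ∷ f) i ≡Finᵇ v)) (sym (map-tabulate {n = n} id suc))
... | true  | eq = cong (zero ∷_) (trans eq (filterᵇ-map _ suc (allFin n)))
... | false | eq = trans eq (filterᵇ-map _ suc (allFin n))

lookup-blocks : (xs : Vec A n) (f : Vec (Fin m) n) (v : Fin m) →
                V.lookup (blocks xs f) v ≡ reverse (map (V.lookup xs) (fibre f v))
lookup-blocks []       []      v = VP.lookup-replicate v []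
lookup-blocks (x ∷ xs) (u ∷ f) v with lookup-blocks xs f v | fibre-∷ u f v | u Fin.≟ v
... | ih | eq | yes refl with toℕ u ≡ᵇ toℕ u | ≡⇒≡ᵇ (toℕ u) (toℕ u) refl
...   | true | _ = begin
  V.lookup (V.updateAt (blocks xs f) u (_∷ʳ x)) u         ≡⟨ VP.lookup∘updateAt u (blocks xs f) ⟩
  V.lookup (blocks xs f) u ∷ʳ x                           ≡⟨ cong (_∷ʳ x) ih ⟩
  reverse (map (V.lookup xs) (fibre f u)) ∷ʳ x            ≡⟨ unfold-reverse x (map (V.lookup xs) (fibre f u)) ⟨
  reverse (x ∷ map (V.lookup xs) (fibre f u))
    ≡⟨ cong (λ is → reverse (x ∷ is)) (map-∘ (fibre f u)) ⟩
  reverse (map (V.lookup (x ∷ xs)) (zero ∷ map suc (fibre f u)))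
    ≡⟨ cong (λ is → reverse (map (V.lookup (x ∷ xs)) is)) eq ⟨
  _ ∎
  where open ≡-Reasoning
lookup-blocks (x ∷ xs) (u ∷ f) v | ih | eq | no u≢v with toℕ u ≡ᵇ toℕ v in u≡ᵇv
... | true  = ⊥-elim (u≢v (FinP.toℕ-injective (≡ᵇ⇒≡ (toℕ u) (toℕ v) (subst T (sym u≡ᵇv) _))))
... | false = begin
  V.lookup (V.updateAt (blocks xs f) u (_∷ʳ x)) v         ≡⟨ VP.lookup∘updateAt′ v u (u≢v ∘ sym) (blocks xs f) ⟩
  V.lookup (blocks xs f) v                                ≡⟨ ih ⟩
  reverse (map (V.lookup xs) (fibre f v))
    ≡⟨ cong reverse (map-∘ (fibre f v)) ⟩
  reverse (map (V.lookup (x ∷ xs)) (map suc (fibre f v)))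
    ≡⟨ cong (λ is → reverse (map (V.lookup (x ∷ xs)) is)) eq ⟨
  _ ∎
  where open ≡-Reasoning

-- Naturality: blocks of indices, which determine the chain, turn into blocks of weights, which
-- determine the monomial and α(s,w).
blocks-map : (g : A → B) (xs : Vec A n) (f : Vec (Fin m) n) →
             blocks (V.map g xs) f ≡ V.map (map g) (blocks xs f)
blocks-map g []       []      = sym (VP.map-replicate (map g) [] _)
blocks-map g (x ∷ xs) (v ∷ f) = trans
  (cong (λ bs → V.updateAt bs v (_∷ʳ g x)) (blocks-map g xs f))
  (sym (VP.map-updateAt (blocks xs f) v (map-++ g (V.lookup (blocks xs f) v) (x ∷ []))))

concatV-map : (g : A → B) (bs : Vec (List A) m) → concatV (V.map (map g) bs) ≡ map g (concatV bs)
concatV-map g bs = trans (cong concat (VP.toList-map (map g) bs)) (concat-map (V.toList bs))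

length-concatV-updateAt : (bs : Vec (List A) m) (v : Fin m) (x : A) →
  length (concatV (V.updateAt bs v (_∷ʳ x))) ≡ suc (length (concatV bs))
length-concatV-updateAt (b ∷ bs) zero x = begin
  length ((b ∷ʳ x) ++ concatV bs)        ≡⟨ length-++ (b ∷ʳ x) ⟩
  length (b ∷ʳ x) + length (concatV bs)  ≡⟨ cong (_+ length (concatV bs)) (trans (length-++ b) (+-comm _ 1)) ⟩
  suc (length b + length (concatV bs))   ≡⟨ cong suc (length-++ b) ⟨
  suc (length (b ++ concatV bs))         ∎
  where open ≡-Reasoning
length-concatV-updateAt (b ∷ bs) (suc v) x = begin
  length (b ++ concatV (V.updateAt bs v (_∷ʳ x)))   ≡⟨ length-++ b ⟩
  length b + _                                      ≡⟨ cong (length b +_) (length-concatV-updateAt bs v x) ⟩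
  length b + suc (length (concatV bs))              ≡⟨ +-suc (length b) _ ⟩
  suc (length b + length (concatV bs))              ≡⟨ cong suc (length-++ b) ⟨
  suc (length (b ++ concatV bs))                    ∎
  where open ≡-Reasoning

length-concatV-blocks : (xs : Vec A n) (f : Vec (Fin m) n) → length (concatV (blocks xs f)) ≡ n
length-concatV-blocks {m = m} [] [] = empty m
  where
  empty : ∀ m → length (concatV (V.replicate m ([] {A = _}))) ≡ 0
  empty zero    = refl
  empty (suc m) = empty m
length-concatV-blocks (x ∷ xs) (v ∷ f) =
  trans (length-concatV-updateAt (blocks xs f) v x) (cong suc (length-concatV-blocks xs f))

-- Lists sorted by a relation

AllPairs-reverse : {R : A → A → Set} {xs : List A} → AllPairs (flip R) xs → AllPairs R (reverse xs)
AllPairs-reverse []                        = []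
AllPairs-reverse {R = R} {x ∷ xs} (px ∷ pxs) = subst (AllPairs R) (sym (unfold-reverse x xs))
  (AllPairsP.++⁺ (AllPairs-reverse pxs) ([] ∷ [])
    (All.tabulate λ y∈ → All.lookup px (AnyP.reverse⁻ y∈) ∷ []))

AllPairs-lookup : {R : A → A → Set} {xs : List A} → AllPairs R xs →
                  ∀ {i j} → i Fin.< j → R (L.lookup xs i) (L.lookup xs j)
AllPairs-lookup (px ∷ pxs) {zero}  {suc j} _         = All.lookup px (∈-lookup j)
AllPairs-lookup (px ∷ pxs) {suc i} {suc j} (s≤s i<j) = AllPairs-lookup pxs i<j

AllPairs-restrict : {P : A → Set} {R S : A → A → Set} → (∀ {x y} → P x → P y → R x y → S x y) →
                    {xs : List A} → All P xs → AllPairs R xs → AllPairs S xs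
AllPairs-restrict f []         []         = []
AllPairs-restrict f (px ∷ pxs) (rx ∷ rxs) =
  All.zipWith (λ (py , rxy) → f px py rxy) (pxs , rx) ∷ AllPairs-restrict f pxs rxs

-- Different heads would each lie in the other's tail and so precede each other. Asymmetry also
-- excludes a second copy of the head, so the tails again have the same entries.
AllPairs-unique : {R : A → A → Set} → (∀ {x y} → R x y → R y x → ⊥) →
  {xs ys : List A} → AllPairs R xs → AllPairs R ys →
  (∀ {x} → x ∈ xs → x ∈ ys) → (∀ {x} → x ∈ ys → x ∈ xs) → xs ≡ ys
AllPairs-unique asym {[]}     {[]}     _ _ _ _ = refl
AllPairs-unique asym {[]}     {y ∷ ys} _ _ _ ⊇ with () ← ⊇ (here refl)
AllPairs-unique asym {x ∷ xs} {[]}     _ _ ⊆ _ with () ← ⊆ (here refl)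
AllPairs-unique {R = R} asym {x ∷ xs} {y ∷ ys} (px ∷ pxs) (py ∷ pys) ⊆ ⊇ with heads
  where
  heads : x ≡ y
  heads with ⊆ (here refl) | ⊇ (here refl)
  ... | here x≡y   | _          = x≡y
  ... | there _    | here y≡x   = sym y≡x
  ... | there x∈ys | there y∈xs = ⊥-elim (asym (All.lookup px y∈xs) (All.lookup py x∈ys))
... | refl = cong (x ∷_) (AllPairs-unique asym pxs pys (tails px ⊆) (tails py ⊇))
  where
  tails : ∀ {us vs} → All (R x) us → (∀ {w} → w ∈ x ∷ us → w ∈ x ∷ vs) → ∀ {w} → w ∈ us → w ∈ vs
  tails pu sub w∈us with sub (there w∈us)
  ... | here refl  = ⊥-elim (asym (All.lookup pu w∈us) (All.lookup pu w∈us))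
  ... | there w∈vs = w∈vs

-- Boolean tests and the order of ℕ_ℕ

toList-tabulate : (xs : Vec A n) → V.toList xs ≡ tabulate (V.lookup xs)
toList-tabulate []       = refl
toList-tabulate (x ∷ xs) = cong (x ∷_) (toList-tabulate xs)

allFinᵇ⁻ : (p : Fin n → Bool) → T (allFinᵇ n p) → ∀ i → T (p i)
allFinᵇ⁻ {n} p h = AllP.tabulate⁻ (AllP.all⁺ p (allFin n) h)

allFinᵇ⁺ : (p : Fin n → Bool) → (∀ i → T (p i)) → T (allFinᵇ n p)
allFinᵇ⁺ p h = AllP.all⁻ p (AllP.tabulate⁺ h)

anyFinᵇ⁻ : (p : Fin n → Bool) → T (anyFinᵇ n p) → ∃ λ i → T (p i)
anyFinᵇ⁻ {n} p h = AnyP.tabulate⁻ (AnyP.any⁻ p (allFin n) h)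

anyFinᵇ⁺ : (p : Fin n → Bool) → ∀ i → T (p i) → T (anyFinᵇ n p)
anyFinᵇ⁺ p i h = AnyP.any⁺ p (AnyP.tabulate⁺ i h)

≡Finᵇ⇒≡ : (i j : Fin n) → T (i ≡Finᵇ j) → i ≡ j
≡Finᵇ⇒≡ i j = FinP.toℕ-injective ∘ ≡ᵇ⇒≡ (toℕ i) (toℕ j)

≡⇒≡Finᵇ : {i j : Fin n} → i ≡ j → T (i ≡Finᵇ j)
≡⇒≡Finᵇ {i = i} {j} = ≡⇒≡ᵇ (toℕ i) (toℕ j) ∘ cong toℕ

implies⁻ : ∀ a {b} → T (not a ∨ b) → T a → T b
implies⁻ true h _ = h

implies⁺ : ∀ a {b} → (T a → T b) → T (not a ∨ b)
implies⁺ true  h = h _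
implies⁺ false h = _

<NNᵇ⁻ : ∀ p q → T (p <NNᵇ q) → proj₁ p < proj₁ q ⊎ (proj₁ p ≡ proj₁ q × proj₂ p < proj₂ q)
<NNᵇ⁻ (a , k) (b , l) h with Equivalence.to (T-∨ {a <ᵇ b}) h
... | inj₁ a<b = inj₁ (<ᵇ⇒< a b a<b)
... | inj₂ h′  with Equivalence.to (T-∧ {a ≡ᵇ b}) h′
...   | a≡b , k<l = inj₂ (≡ᵇ⇒≡ a b a≡b , <ᵇ⇒< k l k<l)

<NNᵇ⁺ : ∀ p q → proj₁ p < proj₁ q ⊎ (proj₁ p ≡ proj₁ q × proj₂ p < proj₂ q) → T (p <NNᵇ q)
<NNᵇ⁺ (a , k) (b , l) (inj₁ a<b)         = Equivalence.from (T-∨ {a <ᵇ b}) (inj₁ (<⇒<ᵇ a<b))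
<NNᵇ⁺ (a , k) (b , l) (inj₂ (a≡b , k<l)) =
  Equivalence.from (T-∨ {a <ᵇ b}) (inj₂ (Equivalence.from T-∧ (≡⇒≡ᵇ a b a≡b , <⇒<ᵇ k<l)))

<NNᵇ-asym : ∀ p q → T (p <NNᵇ q) → T (q <NNᵇ p) → ⊥
<NNᵇ-asym p q p<q q<p with <NNᵇ⁻ p q p<q | <NNᵇ⁻ q p q<p
... | inj₁ a<b         | inj₁ b<a         = <-asym a<b b<a
... | inj₁ a<b         | inj₂ (b≡a , _)   = <-irrefl (sym b≡a) a<b
... | inj₂ (a≡b , _)   | inj₁ b<a         = <-irrefl (sym a≡b) b<a
... | inj₂ (_   , k<l) | inj₂ (_   , l<k) = <-asym k<l l<k

range1-increasing : ∀ n → AllPairs _<_ (range1 n)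
range1-increasing n = AllPairsP.map⁺ (AllPairsP.applyUpTo⁺₁ id n λ i<j _ → s≤s i<j)

elems-increasing : ∀ α → AllPairs (λ p q → T (p <NNᵇ q)) (elems α)
elems-increasing α = AllPairsP.concat⁺
  (AllP.map⁺ (All.universal (λ a → AllPairsP.map⁺ (AllPairs.map
    (λ {k} {l} k<l → <NNᵇ⁺ (a , k) (a , l) (inj₂ (refl , k<l)))
    (range1-increasing (mult a α)))) (range1 (maxPart α))))
  (AllPairsP.map⁺ (AllPairs.map
    (λ {a} {b} a<b →
      AllP.map⁺ (All.universal (λ k →
        AllP.map⁺ (All.universal (λ l → <NNᵇ⁺ (a , k) (b , l) (inj₁ a<b)) (range1 (mult b α))))
        (range1 (mult a α))))
    (range1-increasing (maxPart α))))

map-proj₁-elems : ∀ α → map proj₁ (elems α) ≡ weights α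
map-proj₁-elems α =
  trans (map-concatMap proj₁ _ (range1 (maxPart α))) (concatMap-cong constant (range1 (maxPart α)))
  where
  replicate-map : ∀ (a : ℕ) (ks : List ℕ) → map proj₁ (map (λ k → a , k) ks) ≡ replicate (length ks) a
  replicate-map a []       = refl
  replicate-map a (k ∷ ks) = cong (a ∷_) (replicate-map a ks)
  constant : ∀ a → map proj₁ (map (λ k → a , k) (range1 (mult a α))) ≡ replicate (mult a α) a
  constant a = trans (replicate-map a _) (cong (λ r → replicate r a)
    (trans (length-map suc (upTo (mult a α))) (length-upTo (mult a α))))

-- The chain determined by a map f

module _ (α : List ℕ) {m : ℕ} (f : Vec (Fin m) (card α)) where

  -- The only chain on which f can be an (s,γ)-partition.  Since elems α is
  -- increasing, the order of ℕ_ℕ is that of the indices.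
  _≺_ : Fin (card α) → Fin (card α) → Set
  p ≺ q = V.lookup f p Fin.< V.lookup f q ⊎ (V.lookup f p ≡ V.lookup f q × q Fin.< p)

  ≺-asym : ∀ {p q} → p ≺ q → q ≺ p → ⊥
  ≺-asym (inj₁ fp<fq)       (inj₁ fq<fp)       = <-asym fp<fq fq<fp
  ≺-asym (inj₁ fp<fq)       (inj₂ (fq≡fp , _)) = <-irrefl (cong toℕ (sym fq≡fp)) fp<fq
  ≺-asym (inj₂ (fp≡fq , _)) (inj₁ fq<fp)       = <-irrefl (cong toℕ (sym fp≡fq)) fq<fp
  ≺-asym (inj₂ (_ , q<p))   (inj₂ (_ , p<q))   = <-asym q<p p<q

  elt-monotone : ∀ {p q} → p Fin.< q → T (elt α p <NNᵇ elt α q)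
  elt-monotone = AllPairs-lookup (elems-increasing α)

  stepᵇ : Fin (card α) → Fin (card α) → Bool
  stepᵇ p q = (V.lookup f p ≤Finᵇ V.lookup f q)
            ∧ (not (V.lookup f p ≡Finᵇ V.lookup f q) ∨ (elt α p <γᵇ elt α q))

  stepᵇ⇒≺ : ∀ p q → T (stepᵇ p q) → p ≺ q
  stepᵇ⇒≺ p q h with Equivalence.to (T-∧ {V.lookup f p ≤Finᵇ V.lookup f q}) h
  ... | fp≤ᵇfq , imp with m≤n⇒m<n∨m≡n (≤ᵇ⇒≤ (toℕ (V.lookup f p)) (toℕ (V.lookup f q)) fp≤ᵇfq)
  ...   | inj₁ fp<fq = inj₁ fp<fq
  ...   | inj₂ fp≡fq = inj₂ (fp≡fq′ , q<p)
    where
    fp≡fq′ = FinP.toℕ-injective fp≡fq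
    eltq<eltp : T (elt α q <NNᵇ elt α p)
    eltq<eltp = implies⁻ (V.lookup f p ≡Finᵇ V.lookup f q) imp (≡⇒≡Finᵇ fp≡fq′)
    q<p : q Fin.< p
    -- `elt-monotone` passes from indices to labels; the converse comes from trichotomy of the
    -- indices and asymmetry of the label order.
    q<p with FinP.<-cmp q p
    ... | tri< q<p _ _    = q<p
    ... | tri≈ _ refl _   = ⊥-elim (<NNᵇ-asym (elt α q) (elt α q) eltq<eltp eltq<eltp)
    ... | tri> _ _ p<q    = ⊥-elim (<NNᵇ-asym (elt α q) (elt α p) eltq<eltp (elt-monotone p<q))

  ≺⇒stepᵇ : ∀ p q → p ≺ q → T (stepᵇ p q)
  ≺⇒stepᵇ p q (inj₁ fp<fq) = Equivalence.from T-∧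
    (≤⇒≤ᵇ (<⇒≤ fp<fq) , implies⁺ (V.lookup f p ≡Finᵇ V.lookup f q)
       (λ e → ⊥-elim (<-irrefl (≡ᵇ⇒≡ (toℕ (V.lookup f p)) _ e) fp<fq)))
  ≺⇒stepᵇ p q (inj₂ (fp≡fq , q<p)) = Equivalence.from T-∧
    (≤⇒≤ᵇ (≤-reflexive (cong toℕ fp≡fq)) , implies⁺ (V.lookup f p ≡Finᵇ V.lookup f q) (λ _ → elt-monotone q<p))

  isPartitionᵇ⇒AllPairs : ∀ σ → T (isPartitionᵇ α σ f) → AllPairs _≺_ (V.toList σ)
  isPartitionᵇ⇒AllPairs σ h = subst (AllPairs _≺_) (sym (toList-tabulate σ))
    (AllPairsP.tabulate⁺-< λ {i} {j} i<j → stepᵇ⇒≺ _ _ (implies⁻ (i <Finᵇ j) (allFinᵇ⁻ _ (allFinᵇ⁻ _ h i) j) (<⇒<ᵇ i<j)))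

  module _ (σ : Vec (Fin (card α)) (card α)) (sorted : AllPairs _≺_ (V.toList σ)) where

    ≺-lookup : ∀ i j → i Fin.< j → V.lookup σ i ≺ V.lookup σ j
    ≺-lookup i j = vec-lookup σ sorted i j
      where
      vec-lookup : ∀ {n} (τ : Vec (Fin (card α)) n) → AllPairs _≺_ (V.toList τ) →
                   ∀ i j → i Fin.< j → V.lookup τ i ≺ V.lookup τ j
      vec-lookup (x ∷ τ) (px ∷ _)   zero    (suc j) _         =
        AllP.tabulate⁻ (subst (All (x ≺_)) (toList-tabulate τ) px) j
      vec-lookup (x ∷ τ) (_  ∷ pxs) (suc i) (suc j) (s≤s i<j) = vec-lookup τ pxs i j i<j

    AllPairs⇒isPartitionᵇ : T (isPartitionᵇ α σ f)
    AllPairs⇒isPartitionᵇ = allFinᵇ⁺ _ λ i → allFinᵇ⁺ _ λ j →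
      implies⁺ (i <Finᵇ j) (λ i<ᵇj → ≺⇒stepᵇ _ _ (≺-lookup i j (<ᵇ⇒< (toℕ i) (toℕ j) i<ᵇj)))

    -- Injectivity comes from asymmetry: an element at two positions would precede itself.
    AllPairs⇒isBijᵇ : (∀ e → e ∈ V.toList σ) → T (isBijᵇ α σ)
    AllPairs⇒isBijᵇ complete = Equivalence.from T-∧ (injective , surjective)
      where
      injective = allFinᵇ⁺ _ λ i → allFinᵇ⁺ _ λ j →
        implies⁺ (V.lookup σ i ≡Finᵇ V.lookup σ j) (λ e → ≡⇒≡Finᵇ (inj i j (≡Finᵇ⇒≡ _ _ e)))
        where
        inj : ∀ i j → V.lookup σ i ≡ V.lookup σ j → i ≡ j
        inj i j eq with FinP.<-cmp i j
        ... | tri≈ _ i≡j _ = i≡j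
        ... | tri< i<j _ _ = let lt = subst (V.lookup σ i ≺_) (sym eq) (≺-lookup i j i<j)
                           in ⊥-elim (≺-asym lt lt)
        ... | tri> _ _ j<i = let lt = subst (V.lookup σ j ≺_) eq (≺-lookup j i j<i)
                           in ⊥-elim (≺-asym lt lt)
      surjective = allFinᵇ⁺ _ λ e →
        let i , e≡ = ∈-tabulate⁻ {f = V.lookup σ} (subst (e ∈_) (toList-tabulate σ) (complete e))
        in anyFinᵇ⁺ _ i (≡⇒≡Finᵇ (sym e≡))

  isBijᵇ⇒complete : ∀ σ → T (isBijᵇ α σ) → ∀ e → e ∈ V.toList σ
  isBijᵇ⇒complete σ h e =
    let i , eq = anyFinᵇ⁻ _ (allFinᵇ⁻ _ (proj₂ (Equivalence.to T-∧ h)) e)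
    in subst (e ∈_) (sym (toList-tabulate σ))
         (subst (_∈ tabulate (V.lookup σ)) (≡Finᵇ⇒≡ _ _ eq) (∈-tabulate⁺ i))

  -- Built from `blocks` of the identity listing, so that naturality turns its weights into the
  -- concatenated blocks of the weight word.
  arrangement : List (Fin (card α))
  arrangement = concatV (blocks (V.allFin (card α)) f)

  lookup-blocks-allFin : ∀ v → V.lookup (blocks (V.allFin (card α)) f) v ≡ reverse (fibre f v)
  lookup-blocks-allFin v = trans (lookup-blocks (V.allFin (card α)) f v)
    (cong reverse (trans (map-cong VP.lookup-allFin (fibre f v)) (map-id (fibre f v))))

  arrangement≡ : arrangement ≡ concat (tabulate (λ v → reverse (fibre f v)))
  arrangement≡ = cong concat
    (trans (toList-tabulate (blocks (V.allFin (card α)) f)) (tabulate-cong lookup-blocks-allFin))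

  ∈-fibre⁻ : ∀ {e v} → e ∈ reverse (fibre f v) → V.lookup f e ≡ v
  ∈-fibre⁻ {e} {v} e∈ = ≡Finᵇ⇒≡ _ _ (proj₂
    (∈-filter⁻ (λ i → T? (V.lookup f i ≡Finᵇ v)) {xs = allFin (card α)} (AnyP.reverse⁻ e∈)))

  arrangement-complete : ∀ e → e ∈ arrangement
  arrangement-complete e = subst (e ∈_) (sym arrangement≡) (∈-concat⁺′
    (AnyP.reverse⁺ (∈-filter⁺ (λ i → T? (V.lookup f i ≡Finᵇ V.lookup f e)) (∈-allFin e)
      (≡⇒≡Finᵇ {i = V.lookup f e} refl)))
    (∈-tabulate⁺ (V.lookup f e)))

  -- Inside a reversed fibre the index decreases; from one fibre to the next the value of `f`
  -- increases. These are the two clauses of `_≺_`.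
  arrangement-sorted : AllPairs _≺_ arrangement
  arrangement-sorted = subst (AllPairs _≺_) (sym arrangement≡) (AllPairsP.concat⁺
    (AllP.tabulate⁺ λ v → AllPairs-reverse (AllPairs-restrict
      (λ fp≡v fq≡v p<q → inj₂ (trans fq≡v (sym fp≡v) , p<q))
      (All.tabulate λ e∈ → ∈-fibre⁻ (AnyP.reverse⁺ e∈))
      (AllPairsP.filter⁺ (λ i → T? (V.lookup f i ≡Finᵇ v)) (AllPairsP.tabulate⁺-< {R = Fin._<_} id))))
    (AllPairsP.tabulate⁺-< λ v<v′ → All.tabulate λ p∈ → All.tabulate λ q∈ →
      inj₁ (subst₂ Fin._<_ (sym (∈-fibre⁻ p∈)) (sym (∈-fibre⁻ q∈)) v<v′)))

  arrangementVec : ∃ λ (σ : Vec (Fin (card α)) (card α)) → V.toList σ ≡ arrangement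
  arrangementVec = fromLength arrangement (length-concatV-blocks (V.allFin (card α)) f)
    where
    fromLength : ∀ {n} (xs : List A) → length xs ≡ n → ∃ λ (τ : Vec A n) → V.toList τ ≡ xs
    fromLength xs refl = V.fromList xs , VP.toList∘fromList xs

  -- Only the arrangement of `f` is both bijective and compatible with `f`, so one term survives;
  -- there it remains to ask whether the weights spell `α`. `b` is any test independent of the
  -- chain, later the monomial test.
  ∑-linearExtensions : (b : Bool) →
    ∑ (allVecs (card α) (card α)) (λ σ → 𝟙 (isLinExtWithᵇ α σ) * 𝟙 (isPartitionᵇ α σ f ∧ b)) ≡
    𝟙 b * 𝟙 (eqᵇ (map (wt α) arrangement) α)
  ∑-linearExtensions b = trans (∑-allVecs-single _ σ₀ others) atσ₀
    where
    σ₀ = proj₁ arrangementVec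
    σ₀≡ = proj₂ arrangementVec

    unique : ∀ σ → T (isBijᵇ α σ) → T (isPartitionᵇ α σ f) → σ ≡ σ₀
    unique σ bij part = trans (sym (VP.cast-is-id refl σ)) (VP.toList-injective refl σ σ₀ (trans
      (AllPairs-unique ≺-asym (isPartitionᵇ⇒AllPairs σ part) arrangement-sorted
        (λ {e} _ → arrangement-complete e) (λ {e} _ → isBijᵇ⇒complete σ bij e))
      (sym σ₀≡)))

    others : ∀ σ → σ ≢ σ₀ → 𝟙 (isLinExtWithᵇ α σ) * 𝟙 (isPartitionᵇ α σ f ∧ b) ≡ 0
    others σ σ≢σ₀ with isBijᵇ α σ in bij | isPartitionᵇ α σ f in part
    ... | false | _     = refl
    ... | true  | false = *-zeroʳ (𝟙 (eqᵇ (αsw α σ) α))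
    ... | true  | true  = ⊥-elim (σ≢σ₀ (unique σ (subst T (sym bij) _) (subst T (sym part) _)))

    sorted₀ : AllPairs _≺_ (V.toList σ₀)
    sorted₀ = subst (AllPairs _≺_) (sym σ₀≡) arrangement-sorted

    αsw₀ : αsw α σ₀ ≡ map (wt α) arrangement
    αsw₀ = trans (map-∘ (allFin (card α)))
      (cong (map (wt α)) (trans (map-tabulate id (V.lookup σ₀)) (trans (sym (toList-tabulate σ₀)) σ₀≡)))

    atσ₀ : 𝟙 (isLinExtWithᵇ α σ₀) * 𝟙 (isPartitionᵇ α σ₀ f ∧ b) ≡ 𝟙 b * 𝟙 (eqᵇ (map (wt α) arrangement) α)
    atσ₀ = trans (cong₂ (λ p q → 𝟙 (p ∧ eqᵇ (αsw α σ₀) α) * 𝟙 (q ∧ b))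
        (Equivalence.to T-≡ (AllPairs⇒isBijᵇ σ₀ sorted₀ λ e → subst (e ∈_) (sym σ₀≡) (arrangement-complete e)))
        (Equivalence.to T-≡ (AllPairs⇒isPartitionᵇ σ₀ sorted₀)))
      (trans (*-comm (𝟙 (eqᵇ (αsw α σ₀) α)) (𝟙 b)) (cong (λ ws → 𝟙 b * 𝟙 (eqᵇ ws α)) αsw₀))

-- Coefficients of 𝓅_α as block sums

module _ (α : List ℕ) where

  weightVec : Vec ℕ (card α)
  weightVec = V.map (wt α) (V.allFin (card α))

  toList-weightVec : V.toList weightVec ≡ weights α
  toList-weightVec = begin
    V.toList weightVec                             ≡⟨ VP.toList-map (wt α) (V.allFin (card α)) ⟩
    map (wt α) (V.toList (V.allFin (card α)))
      ≡⟨ cong (map (wt α)) (trans (toList-tabulate (V.allFin (card α))) (tabulate-cong VP.lookup-allFin)) ⟩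
    map (wt α) (allFin (card α))                   ≡⟨ map-∘ (allFin (card α)) ⟩
    map proj₁ (map (elt α) (allFin (card α)))      ≡⟨ cong (map proj₁) (map-tabulate id (elt α)) ⟩
    map proj₁ (tabulate (L.lookup (elems α)))    ≡⟨ cong (map proj₁) (tabulate-lookup (elems α)) ⟩
    map proj₁ (elems α)                            ≡⟨ map-proj₁-elems α ⟩
    weights α                                      ∎
    where open ≡-Reasoning

  hasMonomialᵇ-blocks : ∀ δ f → hasMonomialᵇ α δ f ≡ sumsᵇ δ (blocks weightVec f)
  hasMonomialᵇ-blocks δ f = trans (allFinᵇ-cong λ v → cong (_≡ᵇ L.lookup δ v) (sum-block v))
                                  (sym (sumsᵇ-allFinᵇ δ (blocks weightVec f)))
    where
    open ≡-Reasoning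
    sum-block : ∀ v → sum (map (wt α) (fibre f v)) ≡ sum (V.lookup (blocks weightVec f) v)
    sum-block v = begin
      sum (map (wt α) (fibre f v))
        -- A block is a reversed fibre, and the exponent is insensitive to the order.
        ≡⟨ sum-↭ (↭-reverse (map (wt α) (fibre f v))) ⟨
      sum (reverse (map (wt α) (fibre f v)))
        ≡⟨ cong (sum ∘ reverse) (map-cong (λ i → trans (VP.lookup-map i (wt α) (V.allFin (card α)))
             (cong (wt α) (VP.lookup-allFin i))) (fibre f v)) ⟨
      sum (reverse (map (V.lookup weightVec) (fibre f v)))
        ≡⟨ cong sum (lookup-blocks weightVec f v) ⟨
      sum (V.lookup (blocks weightVec f) v) ∎

  -- Interchanging the sums puts the chains inside, where each `f` keeps only its arrangement. The
  -- remaining sum over `f` runs over distributions of the weights into blocks.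
  pCoeff≡blockCoeff : ∀ δ → pCoeff α δ ≡ blockCoeff α δ (weights α)
  pCoeff≡blockCoeff δ = begin
    pCoeff α δ
      ≡⟨ ∑-filterᵇ (isLinExtWithᵇ α) Σs _ ⟩
    ∑ Σs (λ σ → 𝟙 (isLinExtWithᵇ α σ) * length (filterᵇ (λ f → isPartitionᵇ α σ f ∧ hasMonomialᵇ α δ f) Fs))
      ≡⟨ ∑-cong Σs (λ σ → trans (cong (𝟙 (isLinExtWithᵇ α σ) *_) (length-filterᵇ _ Fs))
                                (sym (∑-*ˡ Fs (𝟙 (isLinExtWithᵇ α σ)) _))) ⟩
    ∑ Σs (λ σ → ∑ Fs (λ f → 𝟙 (isLinExtWithᵇ α σ) * 𝟙 (isPartitionᵇ α σ f ∧ hasMonomialᵇ α δ f)))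
      ≡⟨ ∑-swap Σs Fs _ ⟩
    ∑ Fs (λ f → ∑ Σs (λ σ → 𝟙 (isLinExtWithᵇ α σ) * 𝟙 (isPartitionᵇ α σ f ∧ hasMonomialᵇ α δ f)))
      ≡⟨ ∑-cong Fs (λ f → trans (∑-linearExtensions α f (hasMonomialᵇ α δ f))
           (cong₂ (λ b ws → 𝟙 b * 𝟙 (eqᵇ ws α)) (hasMonomialᵇ-blocks δ f) (sym (concat-weights f)))) ⟩
    ∑ Fs (λ f → 𝟙 (sumsᵇ δ (blocks weightVec f)) * 𝟙 (eqᵇ (concatV (blocks weightVec f)) α))
      ≡⟨ ∑-allVecs weightVec (λ bs → 𝟙 (sumsᵇ δ bs) * 𝟙 (eqᵇ (concatV bs) α)) ⟩
    distSum (length δ) (V.toList weightVec) (λ bs → 𝟙 (sumsᵇ δ bs) * 𝟙 (eqᵇ (concatV bs) α))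
      ≡⟨ distSum-blockSum δ (V.toList weightVec) (λ ws → 𝟙 (eqᵇ ws α)) ⟩
    blockCoeff α δ (V.toList weightVec)
      ≡⟨ cong (blockCoeff α δ) toList-weightVec ⟩
    blockCoeff α δ (weights α) ∎
    where
    open ≡-Reasoning
    Σs = allVecs (card α) (card α)
    Fs = allVecs (length δ) (card α)
    concat-weights : ∀ f → concatV (blocks weightVec f) ≡ map (wt α) (arrangement α f)
    concat-weights f = trans (cong concatV (blocks-map (wt α) (V.allFin (card α)) f))
                             (concatV-map (wt α) (blocks (V.allFin (card α)) f))

-- The coefficient of M_δ ⊗ M_ε on both sides

theorem5p6 : (α : List ℕ) → IsComposition α →
    Δ (𝓅 α) ≐ Σₜ (map (λ βγ → zRatio α (proj₁ βγ) (proj₂ βγ) ·ₜ (𝓅 (proj₁ βγ) ⊗ 𝓅 (proj₂ βγ))) (splits α))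
theorem5p6 α _ δ ε _ _ =
  trans (cong (λ s → pos s / 1) (trans (pCoeff≡blockCoeff α (δ ++ ε)) (blockCoeff-++ α δ ε)))
        (termwise (splits α) (splits-++ α))
  where
  S : List ℕ × List ℕ → ℕ
  S (β , γ) = ∑ (deals (weights α)) (λ (as , bs) → blockCoeff β δ as * blockCoeff γ ε bs)

  term : ∀ β γ → β ++ γ ≡ α → pos (S (β , γ)) / 1 ≡ (zRatio α β γ ·ₜ (𝓅 β ⊗ 𝓅 γ)) δ ε
  -- With `α` replaced by `β ++ γ`, `weights-deals` is the cross-multiplied claim for this split.
  term β γ refl =
    /1-cross (S (β , γ)) (z α) (z β * z γ) (pCoeff β δ) (pCoeff γ ε) {{zz-nonZero β γ}}
      (trans (weights-deals β γ δ ε)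
             (sym (cong₂ (λ s t → z (β ++ γ) * (s * t)) (pCoeff≡blockCoeff β δ) (pCoeff≡blockCoeff γ ε))))

  -- The list of pairs is arbitrary for the sake of the induction: the tail of `splits α` is not
  -- itself a list of all splits.
  termwise : ∀ βγs → All (λ (β , γ) → β ++ γ ≡ α) βγs → pos (∑ βγs S) / 1 ≡
    Σₜ (map (λ βγ → zRatio α (proj₁ βγ) (proj₂ βγ) ·ₜ (𝓅 (proj₁ βγ) ⊗ 𝓅 (proj₂ βγ))) βγs) δ ε
  termwise []              []         = refl
  termwise ((β , γ) ∷ βγs) (eq ∷ eqs) =
    trans (+-/1 (S (β , γ)) (∑ βγs S)) (cong₂ _+ℚ_ (term β γ eq) (termwise βγs eqs))
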